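{- Let $\lambda=(\lambda_1,\dots,\lambda_\ell)$ be a partition, $n\ge1$, $x_1,\dots,x_n>0$, $t\ge0$, and $1\le k<\lambda_1$. Let $\mu$ be the partition with parts $\lambda_i-k$ for those $i$ with $\lambda_i>k$. For $\xi\in\operatorname{Tab}(\lambda,n)$ define $\xi|_\mu\in\operatorname{Tab}(\mu,n)$ by $\xi|_\mu(r,c)=\xi(r+k,c)$. If $\xi$ is random with $\mathbb P(\xi)\propto\operatorname{wt}(\xi)$ on $\operatorname{Tab}(\lambda,n)$, then $\xi|_\mu$ has law $\mathbb P(\xi|_\mu=\sigma)\propto\operatorname{wt}(\sigma)$ on $\operatorname{Tab}(\mu,n)$. Equivalently, for $k=1$ and every $\sigma\in\operatorname{Tab}(\mu,n)$, $\sum_{\xi:\ \xi|_\mu=\sigma}\operatorname{wt}(\xi)=\widetilde H_{\langle1^\ell\rangle}(x_1,\dots,x_n;1,t)\operatorname{wt}(\sigma)$.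
   Context: Fillings: $\operatorname{dg}(\lambda)=\{(r,i):1\le i\le\ell(\lambda),1\le r\le\lambda_i\}$ (row $r$ from the bottom, column $i$ from the left); $\operatorname{Tab}(\lambda,n)$ = maps $\sigma:\operatorname{dg}(\lambda)\to[n]$. $\mathcal Q$ = set of integer triples $(a,b,c)$ with $a<b<c$, or $b<c<a$, or $c<b<a$, or $a=b\ne c$. With $\sigma(\lambda_i+1,i):=0$, $\operatorname{quinv}(\sigma)$ = number of pairs of cells $(r,i),(r,j)$, $i<j$, with $(\sigma(r+1,i),\sigma(r,i),\sigma(r,j))\in\mathcal Q$; $\operatorname{wt}(\sigma)=t^{\operatorname{quinv}(\sigma)}\prod_u x_{\sigma(u)}$. $\widetilde H_{\langle1^\ell\rangle}(x_1,\dots,x_n;1,t)=\sum_{w\in[n]^\ell}t^{\#\{i<j:w_i<w_j\}}\prod_i x_{w_i}$.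
   Formalization: The third case in the definition of 𝒬 is taken as c<a<b instead of the printed c<b<a; with the printed case the claim fails, e.g. for λ=(2,2), n=3, k=1 and top row starting with 3, where the coefficient of x₁x₂ is 2t instead of 1+t. -}

module Defs where

open import Level using (Level; _⊔_) renaming (suc to lsuc)
open import Algebra.Apartness.Bundles using (HeytingField)
open import Algebra.Bundles using (Semiring)
import Algebra.Properties.Semiring.Exp as Exp
open import Data.Fin.Base as Fin using (Fin; zero; suc; toℕ; fromℕ<; cast; _↑ʳ_)
import Data.Fin.Properties as Fin
open import Data.List.Base
  using (List; []; _∷_; map; foldr; filter; length; lookup; concatMap;
         allFin; cartesianProduct; cartesianProductWith)
open import Data.List.Properties using (filter-none)
open import Data.List.Relation.Unary.All as All using (All; []; _∷_)
import Data.List.Relation.Unary.All.Properties as All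
open import Data.List.Relation.Unary.Linked as Linked using (Linked)
import Data.List.Relation.Unary.Linked.Properties as Linked
open import Data.Nat.Base as ℕ using (ℕ; zero; suc; _∸_)
import Data.Nat.Properties as ℕ
open import Data.Product.Base using (∃-syntax; _×_; _,_)
open import Data.Sum.Base using (_⊎_)
open import Data.Vec.Base as Vec using (Vec; []; _∷_)
import Data.Vec.Properties as Vec
open import Relation.Binary.Core using (Rel)
open import Relation.Binary.Definitions using (DecidableEquality)
open import Relation.Binary.PropositionalEquality
  using (_≡_; _≢_; refl; trans; cong; subst)
open import Relation.Binary.Structures using (IsStrictPartialOrder)
open import Relation.Nullary using (¬_; Dec; yes; no)
open import Relation.Nullary.Decidable using (map′; ¬?; _×-dec_; _⊎-dec_)
open import Relation.Unary using (Pred; Decidable)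

------------------------------------------------------------------------
-- Ordered fields

-- With _#_ as the apartness induced by _<_, both the classical and the
-- constructive reals are instances, as is ℚ.
record OrderedField (c ℓ₁ ℓ₂ ℓ₃ : Level) : Set (lsuc (c ⊔ ℓ₁ ⊔ ℓ₂ ⊔ ℓ₃)) where
  infix 4 _<_ _≤_
  field
    heytingField : HeytingField c ℓ₁ ℓ₂
  open HeytingField heytingField public
  field
    _<_                  : Rel Carrier ℓ₃
    isStrictPartialOrder : IsStrictPartialOrder _≈_ _<_
    <⇒#                  : ∀ {x y} → x < y → x # y
    #⇒<⊎>                : ∀ {x y} → x # y → x < y ⊎ y < x
    +-monoˡ-<            : ∀ {x y} z → x < y → x + z < y + z
    *-pos                : ∀ {x y} → 0# < x → 0# < y → 0# < x * y

  _≤_ : Rel Carrier ℓ₃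
  x ≤ y = ¬ (y < x)

  semiring : Semiring c ℓ₁
  semiring = record { isSemiring = isSemiring }

  open Exp semiring public using (_^_)

  ∑ : {a : Level} {A : Set a} → List A → (A → Carrier) → Carrier
  ∑ xs f = foldr _+_ 0# (map f xs)

  ∏ : {a : Level} {A : Set a} → List A → (A → Carrier) → Carrier
  ∏ xs f = foldr _*_ 1# (map f xs)

------------------------------------------------------------------------
-- Partitions

record Partition : Set where
  field
    parts      : List ℕ
    decreasing : Linked ℕ._≥_ parts
    positive   : All (0 ℕ.<_) parts
open Partition public

firstPart : Partition → ℕ
firstPart Λ with parts Λ
... | []    = 0
... | p ∷ _ = p

numParts : Partition → ℕ
numParts Λ = length (parts Λ)

truncateParts : ℕ → List ℕ → List ℕ
truncateParts k ps = map (_∸ k) (filter (k ℕ.<?_) ps)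

truncate : ℕ → Partition → Partition
truncate k Λ .parts      = truncateParts k (parts Λ)
truncate k Λ .decreasing =
  Linked.map⁺ (Linked.map (ℕ.∸-monoˡ-≤ k)
    (Linked.filter⁺ (k ℕ.<?_) (λ p q → ℕ.≤-trans q p) (decreasing Λ)))
truncate k Λ .positive   =
  All.map⁺ (All.map ℕ.m<n⇒0<n∸m (All.all-filter (k ℕ.<?_) (parts Λ)))

------------------------------------------------------------------------
-- Diagrams

-- The cell (r , i) of the diagram is encoded with its column first and with
-- both coordinates counted from 0, so that ⟨ i , r ⟩ has i < ℓ and
-- r < λᵢ; row 0 is the bottom row.
record Cell (ps : List ℕ) : Set where
  constructor ⟨_,_⟩
  field
    colIx : Fin (length ps)
    rowIx : Fin (lookup ps colIx)
open Cell public

col : {ps : List ℕ} → Cell ps → ℕ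
col ⟨ i , _ ⟩ = toℕ i

row : {ps : List ℕ} → Cell ps → ℕ
row ⟨ _ , r ⟩ = toℕ r

cells : (ps : List ℕ) → List (Cell ps)
cells ps = concatMap (λ i → map ⟨ i ,_⟩ (allFin (lookup ps i))) (allFin (length ps))

nextColumn : {p : ℕ} {ps : List ℕ} → Cell ps → Cell (p ∷ ps)
nextColumn ⟨ i , r ⟩ = ⟨ suc i , r ⟩

-- The cell of λ lying k rows above a given cell of μ = truncate k λ.
-- Recursing over an arbitrary list, a removed part would be skipped;
-- by col-shift below this never happens when the list is decreasing.
shiftFilter : {P : Pred ℕ Level.zero} (P? : Decidable P) (k : ℕ) →
              (∀ {p} → P p → k ℕ.≤ p) →
              (ps : List ℕ) → Cell (map (_∸ k) (filter P? ps)) → Cell ps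
shiftFilter P? k k≤ (p ∷ ps) u with P? p
shiftFilter P? k k≤ (p ∷ ps) ⟨ zero  , r ⟩ | yes Pp =
  ⟨ zero , cast (ℕ.m+[n∸m]≡n (k≤ Pp)) (k ↑ʳ r) ⟩
shiftFilter P? k k≤ (p ∷ ps) ⟨ suc i , r ⟩ | yes _  =
  nextColumn (shiftFilter P? k k≤ ps ⟨ i , r ⟩)
shiftFilter P? k k≤ (p ∷ ps) u           | no  _  =
  nextColumn (shiftFilter P? k k≤ ps u)

shift : (k : ℕ) (ps : List ℕ) → Cell (truncateParts k ps) → Cell ps
shift k = shiftFilter (k ℕ.<?_) k ℕ.<⇒≤

row-shiftFilter : {P : Pred ℕ Level.zero} (P? : Decidable P) (k : ℕ) →
                  (k≤ : ∀ {p} → P p → k ℕ.≤ p) (ps : List ℕ) →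
                  (u : Cell (map (_∸ k) (filter P? ps))) →
                  row (shiftFilter P? k k≤ ps u) ≡ k ℕ.+ row u
row-shiftFilter P? k k≤ (p ∷ ps) u with P? p
row-shiftFilter P? k k≤ (p ∷ ps) ⟨ zero  , r ⟩ | yes Pp =
  trans (Fin.toℕ-cast _ (k ↑ʳ r)) (Fin.toℕ-↑ʳ k r)
row-shiftFilter P? k k≤ (p ∷ ps) ⟨ suc i , r ⟩ | yes _  =
  row-shiftFilter P? k k≤ ps ⟨ i , r ⟩
row-shiftFilter P? k k≤ (p ∷ ps) u           | no  _  =
  row-shiftFilter P? k k≤ ps u

col-shiftFilter : {P : Pred ℕ Level.zero} (P? : Decidable P) (k : ℕ) →
                  (k≤ : ∀ {p} → P p → k ℕ.≤ p) →
                  (∀ {p q} → p ℕ.≥ q → P q → P p) →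
                  (ps : List ℕ) → Linked ℕ._≥_ ps →
                  (u : Cell (map (_∸ k) (filter P? ps))) →
                  col (shiftFilter P? k k≤ ps u) ≡ col u
col-shiftFilter P? k k≤ up (p ∷ ps) dec u with P? p
col-shiftFilter P? k k≤ up (p ∷ ps) dec ⟨ zero  , r ⟩ | yes _ = refl
col-shiftFilter P? k k≤ up (p ∷ ps) dec ⟨ suc i , r ⟩ | yes _ =
  cong suc (col-shiftFilter P? k k≤ up ps (Linked.tail dec) ⟨ i , r ⟩)
col-shiftFilter P? k k≤ up (p ∷ ps) dec u | no ¬Pp
  with rest ← Linked.Linked⇒All (λ p≥q q≥r → ℕ.≤-trans q≥r p≥q) ℕ.≤-refl dec
  with () ← subst (λ qs → Fin (length (map (_∸ k) qs)))
              (filter-none P? (All.map (λ p≥q Pq → ¬Pp (up p≥q Pq)) (All.tail rest)))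
              (colIx u)

row-shift : (k : ℕ) (Λ : Partition) (u : Cell (truncateParts k (parts Λ))) →
            row (shift k (parts Λ) u) ≡ k ℕ.+ row u
row-shift k Λ = row-shiftFilter (k ℕ.<?_) k ℕ.<⇒≤ (parts Λ)

col-shift : (k : ℕ) (Λ : Partition) (u : Cell (truncateParts k (parts Λ))) →
            col (shift k (parts Λ) u) ≡ col u
col-shift k Λ = col-shiftFilter (k ℕ.<?_) k ℕ.<⇒≤
  (λ p≥q k<q → ℕ.<-≤-trans k<q p≥q) (parts Λ) (decreasing Λ)

------------------------------------------------------------------------
-- Fillings

-- A map from the diagram to [n], stored as its list of columns, each read
-- from the bottom up, so that propositional equality is equality of maps.
Filling : List ℕ → ℕ → Set
Filling ps n = All (Vec (Fin n)) ps

Tab : Partition → ℕ → Set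
Tab Λ n = Filling (parts Λ) n

infixl 9 _at_
_at_ : {ps : List ℕ} {n : ℕ} → Filling ps n → Cell ps → Fin n
(c ∷ σ) at ⟨ zero  , r ⟩ = Vec.lookup c r
(c ∷ σ) at ⟨ suc i , r ⟩ = σ at ⟨ i , r ⟩

tabulate : {n : ℕ} (ps : List ℕ) → (Cell ps → Fin n) → Filling ps n
tabulate []       f = []
tabulate (p ∷ ps) f =
  Vec.tabulate (λ r → f ⟨ zero , r ⟩) ∷ tabulate ps (λ u → f (nextColumn u))

at-tabulate : {n : ℕ} (ps : List ℕ) (f : Cell ps → Fin n) (u : Cell ps) →
              tabulate ps f at u ≡ f u
at-tabulate (p ∷ ps) f ⟨ zero  , r ⟩ = Vec.lookup∘tabulate (λ r → f ⟨ zero , r ⟩) r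
at-tabulate (p ∷ ps) f ⟨ suc i , r ⟩ = at-tabulate ps (λ u → f (nextColumn u)) ⟨ i , r ⟩

_≟_ : {ps : List ℕ} {n : ℕ} → DecidableEquality (Filling ps n)
[]      ≟ []      = yes refl
(c ∷ σ) ≟ (d ∷ τ) =
  map′ (λ { (refl , refl) → refl }) (λ { refl → refl , refl })
    (Vec.≡-dec Fin._≟_ c d ×-dec σ ≟ τ)

words : (n m : ℕ) → List (Vec (Fin n) m)
words n zero    = [] ∷ []
words n (suc m) = cartesianProductWith _∷_ (allFin n) (words n m)

fillings : (ps : List ℕ) (n : ℕ) → List (Filling ps n)
fillings []       n = [] ∷ []
fillings (p ∷ ps) n = cartesianProductWith _∷_ (words n p) (fillings ps n)

restrict : {n : ℕ} (k : ℕ) (Λ : Partition) → Tab Λ n → Tab (truncate k Λ) n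
restrict k Λ ξ = tabulate (truncateParts k (parts Λ)) (λ u → ξ at shift k (parts Λ) u)

restrict-at : {n : ℕ} (k : ℕ) (Λ : Partition) (ξ : Tab Λ n)
              (u : Cell (truncateParts k (parts Λ))) →
              restrict k Λ ξ at u ≡ ξ at shift k (parts Λ) u
restrict-at k Λ ξ = at-tabulate (truncateParts k (parts Λ)) _

fibre : {n : ℕ} (k : ℕ) (Λ : Partition) → Tab (truncate k Λ) n → List (Tab Λ n)
fibre {n} k Λ σ = filter (λ ξ → restrict k Λ ξ ≟ σ) (fillings (parts Λ) n)

------------------------------------------------------------------------
-- Queue inversions

-- The first three cases say that a, b, c are in cyclic order. Replacing
-- c < a < b by c < b < a would make the marginal identity false, already
-- for λ = (2,2) and n = 3.
𝒬 : ℕ → ℕ → ℕ → Set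
𝒬 a b c = (a ℕ.< b × b ℕ.< c)
        ⊎ (b ℕ.< c × c ℕ.< a)
        ⊎ (c ℕ.< a × a ℕ.< b)
        ⊎ (a ≡ b × b ≢ c)

𝒬? : (a b c : ℕ) → Dec (𝒬 a b c)
𝒬? a b c = (a ℕ.<? b ×-dec b ℕ.<? c)
     ⊎-dec (b ℕ.<? c ×-dec c ℕ.<? a)
     ⊎-dec (c ℕ.<? a ×-dec a ℕ.<? b)
     ⊎-dec (a ℕ.≟ b ×-dec ¬? (b ℕ.≟ c))

-- Entries lie in {1, …, n}; the element i of Fin n stands for i + 1.
value : {ps : List ℕ} {n : ℕ} → Filling ps n → Cell ps → ℕ
value σ u = suc (toℕ (σ at u))

valueAbove : {ps : List ℕ} {n : ℕ} → Filling ps n → Cell ps → ℕ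
valueAbove {ps} σ ⟨ i , r ⟩ with suc (toℕ r) ℕ.<? lookup ps i
... | yes r+1<λᵢ = value σ ⟨ i , fromℕ< r+1<λᵢ ⟩
... | no  _      = 0

QuinvPair : {ps : List ℕ} {n : ℕ} → Filling ps n → Cell ps × Cell ps → Set
QuinvPair σ (u , v) =
  row u ≡ row v × col u ℕ.< col v × 𝒬 (valueAbove σ u) (value σ u) (value σ v)

quinvPair? : {ps : List ℕ} {n : ℕ} (σ : Filling ps n) → Decidable (QuinvPair σ)
quinvPair? σ (u , v) =
  row u ℕ.≟ row v ×-dec col u ℕ.<? col v ×-dec
  𝒬? (valueAbove σ u) (value σ u) (value σ v)

quinv : {ps : List ℕ} {n : ℕ} → Filling ps n → ℕ
quinv {ps} σ = length (filter (quinvPair? σ) (cartesianProduct (cells ps) (cells ps)))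

ascents : {m n : ℕ} → Vec (Fin n) m → ℕ
ascents {m} w = length (filter
  (λ (i , j) → i Fin.<? j ×-dec Vec.lookup w i Fin.<? Vec.lookup w j)
  (cartesianProduct (allFin m) (allFin m)))

------------------------------------------------------------------------
-- Weights and laws

module _ {c ℓ₁ ℓ₂ ℓ₃ : Level} (F : OrderedField c ℓ₁ ℓ₂ ℓ₃) where
  open OrderedField F using (Carrier; _≈_; _≤_; _*_; _^_; 0#; 1#; ∑; ∏)

  wt : {n : ℕ} (x : Fin n → Carrier) (t : Carrier) (Λ : Partition) → Tab Λ n → Carrier
  wt x t Λ σ = t ^ quinv σ * ∏ (cells (parts Λ)) (λ u → x (σ at u))

  -- The modified Macdonald polynomial indexed by (1^m), at q = 1.
  H̃⟨1^_⟩ : (m : ℕ) {n : ℕ} (x : Fin n → Carrier) (t : Carrier) → Carrier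
  H̃⟨1^ m ⟩ {n} x t =
    ∑ (words n m) (λ w → t ^ ascents w * ∏ (allFin m) (λ i → x (Vec.lookup w i)))

  record IsLaw∝ {n : ℕ} (Λ : Partition) (w P : Tab Λ n → Carrier) : Set (c ⊔ ℓ₁ ⊔ ℓ₃) where
    field
      nonNegative  : ∀ σ → 0# ≤ P σ
      normalised   : ∑ (fillings (parts Λ) n) P ≈ 1#
      proportional : ∃[ a ] (∀ σ → P σ ≈ a * w σ)

  restrictedLaw : {n : ℕ} (k : ℕ) (Λ : Partition) →
                  (Tab Λ n → Carrier) → (Tab (truncate k Λ) n → Carrier)
  restrictedLaw k Λ P σ = ∑ (fibre k Λ σ) P

module Submission where

-- Below a fixed row a₁, …, aₘ, the triple condition 𝒬 aᵢ bᵢ bⱼ compares bᵢ with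
-- bⱼ in a linear order depending on aᵢ only, a cyclic rotation of the usual one.
-- The sum over all rows b of t^#{i < j : 𝒬 aᵢ bᵢ bⱼ} f(b), for symmetric f, does
-- not depend on a: by induction every aᵢ beyond the first may be chosen freely,
-- so it suffices to match the contributions of the first two letters, which are
-- either equal for the two choices of a₁ or exchanged with those letters.
-- Taking a = 0 gives the sum over words defining H̃, which is thus the factor by
-- which adding a bottom row multiplies the weight; k rows are removed one at a
-- time.

open import Defs
open import Level using (Level)
open import Data.Fin.Base using (Fin)
open import Data.Nat.Base as ℕ using (ℕ)
open import Data.Product.Base using (_×_)

open import Algebra.Bundles using (CommutativeMonoid; CommutativeSemiring)
import Algebra.Properties.CommutativeSemigroup as CommutativeSemigroup
import Algebra.Properties.Semiring.Exp as Exp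
open import Data.Bool.Base using (Bool; true; false; if_then_else_; _xor_)
import Data.Bool.Properties as Bool
import Data.Fin.Base as Fin
import Data.Fin.Properties as Fin
open import Data.Fin.Base using (zero; suc; toℕ)
open import Data.List.Base as List
  using (List; []; _∷_; _++_; map; foldr; filter; length; concatMap; allFin;
         cartesianProductWith; cartesianProduct; drop)
import Data.List.Properties as List
open import Data.List.Membership.Propositional using (_∈_)
open import Data.List.Membership.Propositional.Properties
  using (∈-filter⁺; ∈-filter⁻; ∈-map⁺; ∈-map⁻; ∈-allFin; ∈-cartesianProductWith⁺)
open import Data.List.Membership.Propositional.Properties.WithK using (unique∧set⇒bag)
open import Data.List.Relation.Binary.BagAndSetEquality using (∼bag⇒↭)
open import Data.List.Relation.Binary.Permutation.Propositional
  using (_↭_; ↭-refl; prep; swap; refl; trans)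
open import Data.List.Relation.Unary.All as All using (All; []; _∷_)
open import Data.List.Relation.Unary.AllPairs using ([]; _∷_)
open import Data.List.Relation.Unary.Any using (here; there)
open import Data.List.Relation.Unary.Unique.Propositional using (Unique)
import Data.List.Relation.Unary.Unique.Propositional.Properties as Unique
open import Data.Nat.Base using (zero; suc; _∸_; s≤s; z≤n)
import Data.Nat.Properties as ℕ
open import Data.Product.Base using (∃-syntax; _,_; proj₁; proj₂)
open import Data.Sum.Base using (_⊎_; inj₁; inj₂)
open import Data.Vec.Base as Vec using (Vec; []; _∷_; toList)
import Data.Vec.Properties as Vec
open import Function.Base using (_∘_; id)
open import Function.Bundles using (mk⇔)
open import Relation.Binary.Definitions using (DecidableEquality)
open import Relation.Binary.PropositionalEquality as ≡ using (_≡_; _≢_; cong; cong₂; subst)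
import Relation.Binary.Reasoning.Setoid as ≈-Reasoning
open import Relation.Binary.Structures using (IsStrictPartialOrder)
open import Relation.Nullary using (¬_; Dec; yes; no; does; ofʸ; ofⁿ; contradiction)
open import Relation.Nullary.Decidable using (dec-true; dec-false; does-⇔; _×-dec_)
open import Relation.Unary using (Pred; Decidable)

-- Cutting the cyclic order at a leaves two intervals, the numbers at least a and those below it.
-- Letters in one interval compare as usual, letters in different intervals the opposite way.
-- Replacing a by 0 also changes comparisons with all later letters, so a is first moved instead:
-- the rows (a, 0, ..., 0) and (0, a, 0, ..., 0) give equal sums, and then a sits above a shorter
-- word.
--
-- The other obstacle is the shape. A column of height one leaves no trace in μ, although the row
-- below has a letter there, and truncating by 1 and then by k gives the shape of truncating by k +
-- 1 only up to a proof of equality. Inversions and restrictions are therefore computed on plain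
-- lists of columns, where empty columns can be inserted or deleted without changing the count.

private variable
  a b p : Level
  A : Set a
  B : Set b
  n m : ℕ

-- Sums over lists in a commutative monoid

module ListSum {c ℓ : Level} (M : CommutativeMonoid c ℓ) where
  open CommutativeMonoid M renaming (refl to ≈-refl; sym to ≈-sym; trans to ≈-trans)
  open CommutativeSemigroup commutativeSemigroup using (interchange; x∙yz≈y∙xz)
  open ≈-Reasoning setoid

  ∑ : List A → (A → Carrier) → Carrier
  ∑ xs f = foldr _∙_ ε (map f xs)

  ∑-cong-∈ : (xs : List A) {f g : A → Carrier} → (∀ {x} → x ∈ xs → f x ≈ g x) → ∑ xs f ≈ ∑ xs g
  ∑-cong-∈ []       f≈g = ≈-refl
  ∑-cong-∈ (x ∷ xs) f≈g = ∙-cong (f≈g (here ≡.refl)) (∑-cong-∈ xs (f≈g ∘ there))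

  ∑-cong : (xs : List A) {f g : A → Carrier} → (∀ x → f x ≈ g x) → ∑ xs f ≈ ∑ xs g
  ∑-cong xs f≈g = ∑-cong-∈ xs (λ {x} _ → f≈g x)

  ∑-ε : (xs : List A) {f : A → Carrier} → (∀ x → f x ≈ ε) → ∑ xs f ≈ ε
  ∑-ε []       f≈ε = ≈-refl
  ∑-ε (x ∷ xs) f≈ε = ≈-trans (∙-cong (f≈ε x) (∑-ε xs f≈ε)) (identityˡ ε)

  ∑-∙ : (xs : List A) (f g : A → Carrier) → ∑ xs (λ x → f x ∙ g x) ≈ ∑ xs f ∙ ∑ xs g
  ∑-∙ []       f g = ≈-sym (identityˡ ε)
  ∑-∙ (x ∷ xs) f g = ≈-trans (∙-congˡ (∑-∙ xs f g)) (interchange _ _ _ _)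

  ∑-swap : (xs : List A) (ys : List B) (f : A → B → Carrier) →
           ∑ xs (λ x → ∑ ys (f x)) ≈ ∑ ys (λ y → ∑ xs (λ x → f x y))
  ∑-swap []       ys f = ≈-sym (∑-ε ys (λ _ → ≈-refl))
  ∑-swap (x ∷ xs) ys f = ≈-trans (∙-congˡ (∑-swap xs ys f)) (≈-sym (∑-∙ ys _ _))

  ∑-map : (h : A → B) (xs : List A) (f : B → Carrier) → ∑ (map h xs) f ≈ ∑ xs (f ∘ h)
  ∑-map h []       f = ≈-refl
  ∑-map h (x ∷ xs) f = ∙-congˡ (∑-map h xs f)

  ∑-++ : (xs ys : List A) (f : A → Carrier) → ∑ (xs ++ ys) f ≈ ∑ xs f ∙ ∑ ys f
  ∑-++ []       ys f = ≈-sym (identityˡ _)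
  ∑-++ (x ∷ xs) ys f = ≈-trans (∙-congˡ (∑-++ xs ys f)) (≈-sym (assoc _ _ _))

  ∑-concatMap : (h : A → List B) (xs : List A) (f : B → Carrier) →
                ∑ (concatMap h xs) f ≈ ∑ xs (λ x → ∑ (h x) f)
  ∑-concatMap h []       f = ≈-refl
  ∑-concatMap h (x ∷ xs) f = ≈-trans (∑-++ (h x) _ f) (∙-congˡ (∑-concatMap h xs f))

  ∑-cartesianProductWith : {C : Set a} (h : A → B → C) (xs : List A) (ys : List B) (f : C → Carrier) →
    ∑ (cartesianProductWith h xs ys) f ≈ ∑ xs (λ x → ∑ ys (λ y → f (h x y)))
  ∑-cartesianProductWith h []       ys f = ≈-refl
  ∑-cartesianProductWith h (x ∷ xs) ys f = ≈-trans (∑-++ (map (h x) ys) _ f)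
    (∙-cong (∑-map (h x) ys f) (∑-cartesianProductWith h xs ys f))

  ∑-allFin-suc : (f : Fin (suc n) → Carrier) →
                 ∑ (allFin (suc n)) f ≈ f zero ∙ ∑ (allFin n) (f ∘ suc)
  ∑-allFin-suc f = ∙-congˡ (≈-trans
    (reflexive (cong (λ xs → ∑ xs f) (≡.sym (List.map-tabulate id suc))))
    (∑-map suc (allFin _) f))

  ∑-lookup : (w : Vec A n) (f : A → Carrier) → ∑ (allFin n) (f ∘ Vec.lookup w) ≈ ∑ (toList w) f
  ∑-lookup []      f = ≈-refl
  ∑-lookup (x ∷ w) f = ≈-trans (∑-allFin-suc (f ∘ Vec.lookup (x ∷ w))) (∙-congˡ (∑-lookup w f))

  ∑-↭ : {xs ys : List A} (f : A → Carrier) → xs ↭ ys → ∑ xs f ≈ ∑ ys f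
  ∑-↭ f refl         = ≈-refl
  ∑-↭ f (prep x p)   = ∙-congˡ (∑-↭ f p)
  ∑-↭ f (swap x y p) = ≈-trans (∙-congˡ (∙-congˡ (∑-↭ f p))) (x∙yz≈y∙xz _ _ _)
  ∑-↭ f (trans p q)  = ≈-trans (∑-↭ f p) (∑-↭ f q)

  ∑-filter-∷ : {P : Pred A p} (P? : Decidable P) (x : A) (xs : List A) (f : A → Carrier) →
    ∑ (filter P? (x ∷ xs)) f ≈ (if does (P? x) then f x else ε) ∙ ∑ (filter P? xs) f
  ∑-filter-∷ P? x xs f with does (P? x)
  ... | true  = ≈-refl
  ... | false = ≈-sym (identityˡ _)

  module _ (_≟_ : DecidableEquality B) where

    ∑-≟-∉ : (ys : List B) {z : B} {r : Carrier} → All (z ≢_) ys →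
            ∑ ys (λ y → if does (z ≟ y) then r else ε) ≈ ε
    ∑-≟-∉ []       []        = ≈-refl
    ∑-≟-∉ (y ∷ ys) (z≢y ∷ z∉) rewrite dec-false (_ ≟ y) z≢y =
      ≈-trans (identityˡ _) (∑-≟-∉ ys z∉)

    ∑-≟-∈ : {ys : List B} {z : B} {r : Carrier} → Unique ys → z ∈ ys →
            ∑ ys (λ y → if does (z ≟ y) then r else ε) ≈ r
    ∑-≟-∈ {ys = y ∷ ys} (y∉ ∷ _) (here ≡.refl) rewrite dec-true (y ≟ y) ≡.refl =
      ≈-trans (∙-congˡ (∑-≟-∉ ys y∉)) (identityʳ _)
    ∑-≟-∈ {ys = y ∷ ys} {z = z} (y∉ ∷ u) (there z∈)
      rewrite dec-false (z ≟ y) (λ { ≡.refl → All.lookup y∉ z∈ ≡.refl }) =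
      ≈-trans (identityˡ _) (∑-≟-∈ u z∈)

    -- Each entry x of `xs` is counted exactly once, at y = h x: that value lies in `ys`, and `ys`
    -- has no repetitions.
    ∑-fibres : (h : A → B) {ys : List B} → Unique ys → (xs : List A) (f : A → Carrier) →
      (∀ {x} → x ∈ xs → h x ∈ ys) → ∑ ys (λ y → ∑ (filter (λ x → h x ≟ y) xs) f) ≈ ∑ xs f
    ∑-fibres h {ys} u []       f hx∈ = ∑-ε ys (λ _ → ≈-refl)
    ∑-fibres h {ys} u (x ∷ xs) f hx∈ = begin
      ∑ ys (λ y → ∑ (filter (λ x → h x ≟ y) (x ∷ xs)) f)
        ≈⟨ ∑-cong ys (λ y → ∑-filter-∷ (λ x → h x ≟ y) x xs f) ⟩
      ∑ ys (λ y → (if does (h x ≟ y) then f x else ε) ∙ ∑ (filter (λ x → h x ≟ y) xs) f)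
        ≈⟨ ∑-∙ ys _ _ ⟩
      ∑ ys (λ y → if does (h x ≟ y) then f x else ε) ∙ ∑ ys (λ y → ∑ (filter (λ x → h x ≟ y) xs) f)
        ≈⟨ ∙-cong (∑-≟-∈ u (hx∈ (here ≡.refl))) (∑-fibres h u xs f (hx∈ ∘ there)) ⟩
      f x ∙ ∑ xs f ∎

  -- The pairs with s x ≢ s y are closed under transposition, so they may be summed with x and y
  -- exchanged while the others stay in place. `g₀` carries the part of g that stays, `g₁` the part
  -- that is transposed.
  ∑∑-switch : (xs : List A) (s : A → Bool) {f g : A → A → Carrier} →
    (∀ x y → s x ≡ s y → f x y ≈ g x y) → (∀ x y → s x ≢ s y → f x y ≈ g y x) →
    ∑ xs (λ x → ∑ xs (f x)) ≈ ∑ xs (λ x → ∑ xs (g x))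
  ∑∑-switch {A = A} xs s {f} {g} same diff = begin
    ∑ xs (λ x → ∑ xs (f x))                        ≈⟨ ∑-cong xs (λ x → ∑-cong xs (f≈ x)) ⟩
    ∑ xs (λ x → ∑ xs (λ y → g₀ x y ∙ g₁ y x))      ≈⟨ split _ _ ⟩
    ∑ xs (λ x → ∑ xs (g₀ x)) ∙ ∑ xs (λ x → ∑ xs (λ y → g₁ y x))
                                                   ≈⟨ ∙-congˡ (∑-swap xs xs _) ⟩
    ∑ xs (λ x → ∑ xs (g₀ x)) ∙ ∑ xs (λ x → ∑ xs (g₁ x))
                                                   ≈⟨ split _ _ ⟨
    ∑ xs (λ x → ∑ xs (λ y → g₀ x y ∙ g₁ x y))      ≈⟨ ∑-cong xs (λ x → ∑-cong xs (≈g x)) ⟩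
    ∑ xs (λ x → ∑ xs (g x))                        ∎
    where
    g₀ g₁ : A → A → Carrier
    g₀ x y = if s x xor s y then ε else g x y
    g₁ x y = if s x xor s y then g x y else ε

    f≈ : ∀ x y → f x y ≈ g₀ x y ∙ g₁ y x
    f≈ x y with s x | s y | same x y | diff x y
    ... | true  | true  | eq | _  = ≈-trans (eq ≡.refl) (≈-sym (identityʳ _))
    ... | false | false | eq | _  = ≈-trans (eq ≡.refl) (≈-sym (identityʳ _))
    ... | true  | false | _  | eq = ≈-trans (eq λ ()) (≈-sym (identityˡ _))
    ... | false | true  | _  | eq = ≈-trans (eq λ ()) (≈-sym (identityˡ _))

    ≈g : ∀ x y → g₀ x y ∙ g₁ x y ≈ g x y
    ≈g x y with s x xor s y
    ... | true  = identityˡ _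
    ... | false = identityʳ _

    split : (g h : A → A → Carrier) → ∑ xs (λ x → ∑ xs (λ y → g x y ∙ h x y)) ≈
            ∑ xs (λ x → ∑ xs (g x)) ∙ ∑ xs (λ x → ∑ xs (h x))
    split g h = ≈-trans (∑-cong xs (λ x → ∑-∙ xs (g x) (h x))) (∑-∙ xs _ _)

-- The cyclic order and sums over a single row

module ∑ℕ = ListSum ℕ.+-0-commutativeMonoid

𝟙 : {P : Set p} → Dec P → ℕ
𝟙 P? = if does P? then 1 else 0

𝟙-cong : {P : Set a} {Q : Set b} (P? : Dec P) (Q? : Dec Q) → (P → Q) → (Q → P) → 𝟙 P? ≡ 𝟙 Q?
𝟙-cong P? Q? P⇒Q Q⇒P = cong (if_then 1 else 0) (does-⇔ (mk⇔ P⇒Q Q⇒P) P? Q?)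

𝟙-no : {P : Set p} (P? : Dec P) → ¬ P → 𝟙 P? ≡ 0
𝟙-no P? ¬P = cong (if_then 1 else 0) (dec-false P? ¬P)

length-filter : {P : Pred A p} (P? : Decidable P) (xs : List A) →
                length (filter P? xs) ≡ ∑ℕ.∑ xs (𝟙 ∘ P?)
length-filter P? []       = ≡.refl
length-filter P? (x ∷ xs) with does (P? x)
... | true  = cong suc (length-filter P? xs)
... | false = length-filter P? xs

length-filter-cartesianProduct :
  {P : Pred (A × B) p} (P? : Decidable P) (xs : List A) (ys : List B) →
  length (filter P? (cartesianProduct xs ys)) ≡ ∑ℕ.∑ xs (λ x → ∑ℕ.∑ ys (λ y → 𝟙 (P? (x , y))))
length-filter-cartesianProduct P? xs ys = ≡.trans
  (length-filter P? (cartesianProduct xs ys)) (∑ℕ.∑-cartesianProductWith _,_ xs ys (𝟙 ∘ P?))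

-- 𝒬 a b c says that b strictly precedes c in the cyclic order of ℕ cut open
-- just below a: the numbers on the upper side of a come first, and each side
-- keeps its usual order.
upper : ℕ → ℕ → Bool
upper = ℕ._≤ᵇ_

χ : ℕ → ℕ → ℕ → ℕ
χ a b c = 𝟙 (𝒬? a b c)

-- The clause a ≡ b of `𝒬` makes a itself the least number of the upper side: for a ≤ c, the
-- condition b ≢ c then means b < c.
χ-same : ∀ a b c → upper a b ≡ upper a c → χ a b c ≡ 𝟙 (b ℕ.<? c)
χ-same a b c with a ℕ.≤ᵇ b | ℕ.≤ᵇ-reflects-≤ a b | a ℕ.≤ᵇ c | ℕ.≤ᵇ-reflects-≤ a c
... | true | ofʸ a≤b | true | ofʸ a≤c = λ _ → 𝟙-cong (𝒬? a b c) (b ℕ.<? c)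
  (λ { (inj₁ (_ , b<c))                → b<c
     ; (inj₂ (inj₁ (b<c , _)))         → b<c
     ; (inj₂ (inj₂ (inj₁ (c<a , _))))  → contradiction a≤c (ℕ.<⇒≱ c<a)
     ; (inj₂ (inj₂ (inj₂ (≡.refl , b≢c)))) → ℕ.≤∧≢⇒< a≤c b≢c })
  (λ b<c → case (ℕ.m≤n⇒m<n∨m≡n a≤b) b<c)
  where
  case : a ℕ.< b ⊎ a ≡ b → b ℕ.< c → 𝒬 a b c
  case (inj₁ a<b) b<c = inj₁ (a<b , b<c)
  case (inj₂ a≡b) b<c = inj₂ (inj₂ (inj₂ (a≡b , ℕ.<⇒≢ b<c)))
... | false | ofⁿ a≰b | false | ofⁿ a≰c = λ _ → 𝟙-cong (𝒬? a b c) (b ℕ.<? c)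
  (λ { (inj₁ (_ , b<c))                → b<c
     ; (inj₂ (inj₁ (b<c , _)))         → b<c
     ; (inj₂ (inj₂ (inj₁ (_ , a<b))))  → contradiction (ℕ.<⇒≤ a<b) a≰b
     ; (inj₂ (inj₂ (inj₂ (a≡b , _))))  → contradiction (ℕ.≤-reflexive a≡b) a≰b })
  (λ b<c → inj₂ (inj₁ (b<c , ℕ.≰⇒> a≰c)))
... | true | ofʸ _ | false | ofⁿ _ = λ ()
... | false | ofⁿ _ | true | ofʸ _ = λ ()

-- If b is on the upper side and c is not, both conditions hold; in the opposite case both fail.
χ-diff : ∀ a b c → upper a b ≢ upper a c → χ a b c ≡ 𝟙 (c ℕ.<? b)
χ-diff a b c with a ℕ.≤ᵇ b | ℕ.≤ᵇ-reflects-≤ a b | a ℕ.≤ᵇ c | ℕ.≤ᵇ-reflects-≤ a c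
... | true | ofʸ a≤b | false | ofⁿ a≰c = λ _ → 𝟙-cong (𝒬? a b c) (c ℕ.<? b)
  (λ _ → ℕ.<-≤-trans (ℕ.≰⇒> a≰c) a≤b)
  (λ c<b → case (ℕ.m≤n⇒m<n∨m≡n a≤b) c<b)
  where
  case : a ℕ.< b ⊎ a ≡ b → c ℕ.< b → 𝒬 a b c
  case (inj₁ a<b) c<b = inj₂ (inj₂ (inj₁ (ℕ.≰⇒> a≰c , a<b)))
  case (inj₂ a≡b) c<b = inj₂ (inj₂ (inj₂ (a≡b , ℕ.>⇒≢ c<b)))
... | false | ofⁿ a≰b | true | ofʸ a≤c = λ _ → 𝟙-cong (𝒬? a b c) (c ℕ.<? b)
  (λ { (inj₁ (a<b , _))                → contradiction (ℕ.<⇒≤ a<b) a≰b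
     ; (inj₂ (inj₁ (_ , c<a)))         → contradiction a≤c (ℕ.<⇒≱ c<a)
     ; (inj₂ (inj₂ (inj₁ (_ , a<b))))  → contradiction (ℕ.<⇒≤ a<b) a≰b
     ; (inj₂ (inj₂ (inj₂ (a≡b , _))))  → contradiction (ℕ.≤-reflexive a≡b) a≰b })
  (λ c<b → contradiction (ℕ.≤-trans a≤c (ℕ.<⇒≤ c<b)) a≰b)
... | true | ofʸ _ | true | ofʸ _ = λ ≢ → contradiction ≡.refl ≢
... | false | ofⁿ _ | false | ofⁿ _ = λ ≢ → contradiction ≡.refl ≢

χ-zero : ∀ b c → χ 0 b c ≡ 𝟙 (b ℕ.<? c)
χ-zero b c = χ-same 0 b c ≡.refl

-- Both sides are intervals, so a number d on the side not containing b and c is below both or above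
-- both.
<-across : ∀ a b c d → upper a b ≡ upper a c → upper a b ≢ upper a d →
           𝟙 (b ℕ.<? d) ≡ 𝟙 (c ℕ.<? d) × 𝟙 (d ℕ.<? b) ≡ 𝟙 (d ℕ.<? c)
<-across a b c d
  with a ℕ.≤ᵇ b | ℕ.≤ᵇ-reflects-≤ a b | a ℕ.≤ᵇ c | ℕ.≤ᵇ-reflects-≤ a c
     | a ℕ.≤ᵇ d | ℕ.≤ᵇ-reflects-≤ a d
... | true | ofʸ a≤b | true | ofʸ a≤c | false | ofⁿ a≰d = λ _ _ →
    𝟙-cong (b ℕ.<? d) (c ℕ.<? d)
      (λ b<d → contradiction (ℕ.≤-trans a≤b (ℕ.<⇒≤ b<d)) a≰d)
      (λ c<d → contradiction (ℕ.≤-trans a≤c (ℕ.<⇒≤ c<d)) a≰d)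
  , 𝟙-cong (d ℕ.<? b) (d ℕ.<? c)
      (λ _ → ℕ.<-≤-trans (ℕ.≰⇒> a≰d) a≤c) (λ _ → ℕ.<-≤-trans (ℕ.≰⇒> a≰d) a≤b)
... | false | ofⁿ a≰b | false | ofⁿ a≰c | true | ofʸ a≤d = λ _ _ →
    𝟙-cong (b ℕ.<? d) (c ℕ.<? d)
      (λ _ → ℕ.<-≤-trans (ℕ.≰⇒> a≰c) a≤d) (λ _ → ℕ.<-≤-trans (ℕ.≰⇒> a≰b) a≤d)
  , 𝟙-cong (d ℕ.<? b) (d ℕ.<? c)
      (λ d<b → contradiction (ℕ.≤-trans a≤d (ℕ.<⇒≤ d<b)) a≰b)
      (λ d<c → contradiction (ℕ.≤-trans a≤d (ℕ.<⇒≤ d<c)) a≰c)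
... | true | ofʸ _ | false | ofⁿ _ | _ | _ = λ ()
... | false | ofⁿ _ | true | ofʸ _ | _ | _ = λ ()
... | true | ofʸ _ | true | ofʸ _ | true | ofʸ _ = λ _ ≢ → contradiction ≡.refl ≢
... | false | ofⁿ _ | false | ofⁿ _ | false | ofⁿ _ = λ _ ≢ → contradiction ≡.refl ≢

-- If d is on the side of b and c, all four comparisons are the usual ones and the two terms merely
-- change order. Otherwise d cannot tell b from c, so these may be interchanged in each term.
χ-exchange : ∀ a b c d → upper a b ≡ upper a c → χ a b d ℕ.+ χ 0 c d ≡ χ a c d ℕ.+ χ 0 b d
χ-exchange a b c d b~c with upper a b Bool.≟ upper a d
... | yes b~d
  rewrite χ-same a b d b~d | χ-same a c d (≡.trans (≡.sym b~c) b~d) | χ-zero b d | χ-zero c d =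
  ℕ.+-comm (𝟙 (b ℕ.<? d)) _
... | no b≁d
  rewrite χ-diff a b d b≁d | χ-diff a c d (b≁d ∘ ≡.trans b~c) | χ-zero b d | χ-zero c d
        | proj₁ (<-across a b c d b~c b≁d) | proj₂ (<-across a b c d b~c b≁d) = ≡.refl

ι : Fin n → ℕ
ι = suc ∘ toℕ

inv : ℕ → Fin n → List (Fin n) → ℕ
inv a b w = ∑ℕ.∑ w (λ d → χ a (ι b) (ι d))

inv-exchange : ∀ a (b c : Fin n) w → upper a (ι b) ≡ upper a (ι c) →
               inv a b w ℕ.+ inv 0 c w ≡ inv a c w ℕ.+ inv 0 b w
inv-exchange a b c w b~c = begin
  inv a b w ℕ.+ inv 0 c w
    ≡⟨ ∑ℕ.∑-∙ w _ _ ⟨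
  ∑ℕ.∑ w (λ d → χ a (ι b) (ι d) ℕ.+ χ 0 (ι c) (ι d))
    ≡⟨ ∑ℕ.∑-cong w (λ d → χ-exchange a (ι b) (ι c) (ι d) b~c) ⟩
  ∑ℕ.∑ w (λ d → χ a (ι c) (ι d) ℕ.+ χ 0 (ι b) (ι d))
    ≡⟨ ∑ℕ.∑-∙ w _ _ ⟩
  inv a c w ℕ.+ inv 0 b w ∎
  where open ≡.≡-Reasoning

-- The queue inversions of a word w lying directly below the row us.
rowInv : Vec ℕ m → Vec (Fin n) m → ℕ
rowInv []       []      = 0
rowInv (a ∷ us) (b ∷ w) = inv a b (toList w) ℕ.+ rowInv us w

-- Independence of a row sum from the row above

module RowSum {c ℓ : Level} (R : CommutativeSemiring c ℓ)
              (t : CommutativeSemiring.Carrier R) (n : ℕ) where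
  open CommutativeSemiring R renaming (refl to ≈-refl; sym to ≈-sym; trans to ≈-trans)
  open Exp semiring using (_^_; ^-homo-*)
  open CommutativeSemigroup *-commutativeSemigroup using (x∙yz≈y∙xz)
  open ListSum +-commutativeMonoid
  open ≈-Reasoning setoid

  ∑-*ˡ : (r : Carrier) (xs : List A) (f : A → Carrier) → ∑ xs (λ x → r * f x) ≈ r * ∑ xs f
  ∑-*ˡ r []       f = ≈-sym (zeroʳ r)
  ∑-*ˡ r (x ∷ xs) f = ≈-trans (+-congˡ (∑-*ˡ r xs f)) (≈-sym (distribˡ r _ _))

  ∑-*ʳ : (r : Carrier) (xs : List A) (f : A → Carrier) → ∑ xs (λ x → f x * r) ≈ ∑ xs f * r
  ∑-*ʳ r []       f = ≈-sym (zeroˡ r)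
  ∑-*ʳ r (x ∷ xs) f = ≈-trans (+-congˡ (∑-*ʳ r xs f)) (≈-sym (distribʳ r _ _))

  Symmetric : (List (Fin n) → Carrier) → Set ℓ
  Symmetric f = ∀ {v w} → v ↭ w → f v ≈ f w

  rowSum : Vec ℕ m → (List (Fin n) → Carrier) → Carrier
  rowSum {m} us f = ∑ (words n m) (λ w → t ^ rowInv us w * f (toList w))

  -- All comparisons made by a first letter b below a are absorbed into the function being summed,
  -- which leaves a row sum one letter shorter.
  prepend : ℕ → Fin n → (List (Fin n) → Carrier) → List (Fin n) → Carrier
  prepend a b f w = t ^ inv a b w * f (b ∷ w)

  -- `inv` sees the later letters only as a multiset, so fixing the first letter stays within
  -- symmetric functions, as the induction in `rowSum-zero` requires.
  prepend-symmetric : ∀ a b {f} → Symmetric f → Symmetric (prepend a b f)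
  prepend-symmetric a b sf v↭w = *-cong (reflexive (cong (t ^_) (∑ℕ.∑-↭ _ v↭w))) (sf (prep b v↭w))

  rowSum-cong : (us : Vec ℕ m) {f g : List (Fin n) → Carrier} → (∀ w → f w ≈ g w) →
                rowSum us f ≈ rowSum us g
  rowSum-cong {m} us f≈g = ∑-cong (words n m) (λ w → *-congˡ (f≈g (toList w)))

  rowSum-∷ : ∀ a (us : Vec ℕ m) f →
             rowSum (a ∷ us) f ≈ ∑ (allFin n) (λ b → rowSum us (prepend a b f))
  rowSum-∷ {m} a us f = ≈-trans (∑-cartesianProductWith _∷_ (allFin n) (words n m) _)
    (∑-cong (allFin n) (λ b → ∑-cong (words n m) (λ w → begin
      t ^ (inv a b (toList w) ℕ.+ rowInv us w) * f (b ∷ toList w)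
        ≈⟨ *-congʳ (^-homo-* t (inv a b (toList w)) (rowInv us w)) ⟩
      t ^ inv a b (toList w) * t ^ rowInv us w * f (b ∷ toList w)
        ≈⟨ ≈-trans (*-assoc _ _ _) (x∙yz≈y∙xz _ _ _) ⟩
      t ^ rowInv us w * prepend a b f (toList w) ∎)))

  private
    -- The inner `prepend` supplies the first letter b, the outer one the second letter c; hence b
    -- is compared with c under a, and a′ governs only comparisons with w.
    prepend² : ∀ a a′ b c f w → prepend a′ c (prepend a b f) w ≈
               t ^ (χ a (ι b) (ι c) ℕ.+ (inv a b w ℕ.+ inv a′ c w)) * f (b ∷ c ∷ w)
    prepend² a a′ b c f w = begin
      t ^ inv a′ c w * (t ^ (χ a (ι b) (ι c) ℕ.+ inv a b w) * f (b ∷ c ∷ w))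
        ≈⟨ *-assoc _ _ _ ⟨
      t ^ inv a′ c w * t ^ (χ a (ι b) (ι c) ℕ.+ inv a b w) * f (b ∷ c ∷ w)
        ≈⟨ *-congʳ (*-comm _ _) ⟩
      t ^ (χ a (ι b) (ι c) ℕ.+ inv a b w) * t ^ inv a′ c w * f (b ∷ c ∷ w)
        ≈⟨ *-congʳ (^-homo-* t (χ a (ι b) (ι c) ℕ.+ inv a b w) (inv a′ c w)) ⟨
      t ^ (χ a (ι b) (ι c) ℕ.+ inv a b w ℕ.+ inv a′ c w) * f (b ∷ c ∷ w)
        ≡⟨ cong (λ e → t ^ e * f (b ∷ c ∷ w)) (ℕ.+-assoc (χ a (ι b) (ι c)) _ _) ⟩
      t ^ (χ a (ι b) (ι c) ℕ.+ (inv a b w ℕ.+ inv a′ c w)) * f (b ∷ c ∷ w) ∎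

  -- The letters stay and the entries a and 0 above them trade places: b and c compare as usual
  -- under either entry, and `inv-exchange` handles the later letters.
  prepend²-same : ∀ a b c f w → upper a (ι b) ≡ upper a (ι c) →
    prepend 0 c (prepend a b f) w ≈ prepend a c (prepend 0 b f) w
  prepend²-same a b c f w b~c = begin
    prepend 0 c (prepend a b f) w ≈⟨ prepend² a 0 b c f w ⟩
    t ^ (χ a (ι b) (ι c) ℕ.+ (inv a b w ℕ.+ inv 0 c w)) * f (b ∷ c ∷ w)
      ≡⟨ cong (λ e → t ^ e * f (b ∷ c ∷ w)) (cong₂ ℕ._+_
           (≡.trans (χ-same a (ι b) (ι c) b~c) (≡.sym (χ-zero (ι b) (ι c))))
           (≡.trans (inv-exchange a b c w b~c) (ℕ.+-comm (inv a c w) _))) ⟩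
    t ^ (χ 0 (ι b) (ι c) ℕ.+ (inv 0 b w ℕ.+ inv a c w)) * f (b ∷ c ∷ w)
      ≈⟨ prepend² 0 a b c f w ⟨
    prepend a c (prepend 0 b f) w ∎

  -- Here the entries above travel with their letters: a over b and 0 over c trade places. Comparing
  -- b with c under a is comparing c with b under 0, and symmetry of f absorbs the new order.
  prepend²-diff : ∀ a b c {f} w → Symmetric f → upper a (ι b) ≢ upper a (ι c) →
    prepend 0 c (prepend a b f) w ≈ prepend a b (prepend 0 c f) w
  prepend²-diff a b c {f} w sf b≁c = begin
    prepend 0 c (prepend a b f) w ≈⟨ prepend² a 0 b c f w ⟩
    t ^ (χ a (ι b) (ι c) ℕ.+ (inv a b w ℕ.+ inv 0 c w)) * f (b ∷ c ∷ w)
      ≡⟨ cong (λ e → t ^ e * f (b ∷ c ∷ w)) (cong₂ ℕ._+_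
           (≡.trans (χ-diff a (ι b) (ι c) b≁c) (≡.sym (χ-zero (ι c) (ι b))))
           (ℕ.+-comm (inv a b w) _)) ⟩
    t ^ (χ 0 (ι c) (ι b) ℕ.+ (inv 0 c w ℕ.+ inv a b w)) * f (b ∷ c ∷ w)
      ≈⟨ *-congˡ (sf (swap b c ↭-refl)) ⟩
    t ^ (χ 0 (ι c) (ι b) ℕ.+ (inv 0 c w ℕ.+ inv a b w)) * f (c ∷ b ∷ w)
      ≈⟨ prepend² 0 a c b f w ⟨
    prepend a b (prepend 0 c f) w ∎

  -- Peel off the first two letters on either side, using the induction
  -- hypothesis to choose freely what lies above the second one; then match the
  -- pairs (b , c) with themselves or with (c , b).
  rowSum-zero : (us : Vec ℕ m) {f : List (Fin n) → Carrier} → Symmetric f →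
                rowSum us f ≈ rowSum (Vec.replicate m 0) f
  rowSum-zero []                 sf = ≈-refl
  -- A single letter makes no comparison, so a drops out by computation.
  rowSum-zero (a ∷ [])     {f} sf = ≈-trans (rowSum-∷ a [] f) (≈-sym (rowSum-∷ 0 [] f))
  rowSum-zero {suc (suc m)} (a ∷ us@(_ ∷ _)) {f} sf = begin
    rowSum (a ∷ us) f
      ≈⟨ rowSum-∷ a us f ⟩
    ∑ (allFin n) (λ b → rowSum us (prepend a b f))
      ≈⟨ ∑-cong (allFin n) (λ b → ≈-trans
           (rowSum-zero us (prepend-symmetric a b sf)) (rowSum-∷ 0 0s (prepend a b f))) ⟩
    ∑ (allFin n) (λ b → ∑ (allFin n) (λ c → rowSum 0s (prepend 0 c (prepend a b f))))
      ≈⟨ ∑∑-switch (allFin n) (upper a ∘ ι)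
           (λ b c b~c → rowSum-cong 0s (λ w → prepend²-same a b c f w b~c))
           (λ b c b≁c → rowSum-cong 0s (λ w → prepend²-diff a b c w sf b≁c)) ⟩
    ∑ (allFin n) (λ b → ∑ (allFin n) (λ c → rowSum 0s (prepend a c (prepend 0 b f))))
      -- The entry a now lies above the second letter, and `a ∷ 0s` is one entry shorter than
      -- `a ∷ us`.
      ≈⟨ ∑-cong (allFin n) (λ b → ≈-trans (≈-sym (rowSum-∷ a 0s (prepend 0 b f)))
           (rowSum-zero (a ∷ 0s) (prepend-symmetric 0 b sf))) ⟩
    ∑ (allFin n) (λ b → rowSum (0 ∷ 0s) (prepend 0 b f))
      ≈⟨ rowSum-∷ 0 (0 ∷ 0s) f ⟨
    rowSum (0 ∷ 0 ∷ 0s) f ∎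
    where
    0s = Vec.replicate m 0

-- Fillings as lists of columns

private variable
  ps : List ℕ

columns : Filling ps n → List (List (Fin n))
columns []      = []
columns (c ∷ σ) = toList c ∷ columns σ

columns-injective : (σ τ : Filling ps n) → columns σ ≡ columns τ → σ ≡ τ
columns-injective []      []      _  = ≡.refl
columns-injective (c ∷ σ) (d ∷ τ) eq = cong₂ _∷_
  (≡.trans (≡.sym (Vec.cast-is-id ≡.refl c)) (Vec.toList-injective ≡.refl c d (List.∷-injectiveˡ eq)))
  (columns-injective σ τ (List.∷-injectiveʳ eq))

module CellSum {c ℓ : Level} (M : CommutativeMonoid c ℓ) where
  open CommutativeMonoid M renaming (refl to ≈-refl; sym to ≈-sym; trans to ≈-trans)
  open ListSum M

  ∑-cells : (ps : List ℕ) (f : Cell ps → Carrier) →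
    ∑ (cells ps) f ≈ ∑ (allFin (length ps)) (λ i → ∑ (allFin (List.lookup ps i)) (λ r → f ⟨ i , r ⟩))
  ∑-cells ps f = ≈-trans (∑-concatMap _ (allFin (length ps)) f)
    (∑-cong (allFin (length ps)) (λ i → ∑-map ⟨ i ,_⟩ (allFin (List.lookup ps i)) f))

  ∑-cells-∷ : ∀ p ps (f : Cell (p ∷ ps) → Carrier) →
    ∑ (cells (p ∷ ps)) f ≈ ∑ (allFin p) (λ r → f ⟨ zero , r ⟩) ∙ ∑ (cells ps) (f ∘ nextColumn)
  ∑-cells-∷ p ps f = ≈-trans (∑-cells (p ∷ ps) f)
    (≈-trans (∑-allFin-suc (λ i → ∑ (allFin (List.lookup (p ∷ ps) i)) (λ r → f ⟨ i , r ⟩)))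
      (∙-congˡ (≈-sym (∑-cells ps (f ∘ nextColumn)))))

  ∑-entries : (σ : Filling ps n) (f : Fin n → Carrier) →
    ∑ (cells ps) (λ u → f (σ at u)) ≈ ∑ (columns σ) (λ c → ∑ c f)
  ∑-entries {[]}     []      f = ≈-refl
  ∑-entries {p ∷ ps} (c ∷ σ) f = ≈-trans (∑-cells-∷ p ps (λ u → f ((c ∷ σ) at u)))
    (∙-cong (∑-lookup c f) (∑-entries σ f))

open CellSum ℕ.+-0-commutativeMonoid using () renaming (∑-cells-∷ to ∑ℕ-cells-∷)

-- The value 0 at an empty list is the convention for the cell just above a column.
top : List (Fin n) → ℕ
top []      = 0
top (b ∷ _) = ι b

-- Inversions between a left and a right column, read upwards in parallel. Only the left column is
-- asked for the entry above, and rows beyond the shorter column contribute nothing.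
pairInv : List (Fin n) → List (Fin n) → ℕ
pairInv []      _       = 0
pairInv (b ∷ c) []      = 0
pairInv (b ∷ c) (e ∷ d) = χ (top c) (ι b) (ι e) ℕ.+ pairInv c d

columnsInv : List (List (Fin n)) → ℕ
columnsInv []       = 0
columnsInv (c ∷ cs) = ∑ℕ.∑ cs (pairInv c) ℕ.+ columnsInv cs

above : Vec (Fin n) m → Fin m → ℕ
above (b ∷ c) zero    = top (toList c)
above (b ∷ c) (suc r) = above c r

valueAbove-first : ∀ {p} (c : Vec (Fin n) p) (σ : Filling ps n) r →
                   valueAbove (c ∷ σ) ⟨ zero , r ⟩ ≡ above c r
valueAbove-first (b ∷ [])     σ zero = ≡.refl
valueAbove-first (b ∷ b′ ∷ c) σ zero = ≡.refl
valueAbove-first {p = suc p} (b ∷ c) σ (suc r)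
  with valueAbove-first c σ r
... | ih with suc (toℕ r) ℕ.<? p | suc (suc (toℕ r)) ℕ.<? suc p
... | yes r< | yes r<′ = ≡.trans (cong (λ s → ι (Vec.lookup c s)) (Fin.fromℕ<-cong _ _ ≡.refl _ _)) ih
... | no _   | no _    = ih
... | yes r< | no r≮   = contradiction (s≤s r<) r≮
... | no r≮  | yes r<  = contradiction (ℕ.s≤s⁻¹ r<) r≮

valueAbove-next : ∀ {p} (c : Vec (Fin n) p) (σ : Filling ps n) u →
                  valueAbove (c ∷ σ) (nextColumn u) ≡ valueAbove σ u
valueAbove-next {ps = ps} c σ ⟨ i , r ⟩ with suc (toℕ r) ℕ.<? List.lookup ps i
... | yes _ = ≡.refl
... | no _  = ≡.refl

pairInv-cells : ∀ {p q} (c : Vec (Fin n) p) (d : Vec (Fin n) q) →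
  ∑ℕ.∑ (allFin p) (λ r → ∑ℕ.∑ (allFin q) (λ s →
    𝟙 (toℕ r ℕ.≟ toℕ s ×-dec 𝒬? (above c r) (ι (Vec.lookup c r)) (ι (Vec.lookup d s)))))
  ≡ pairInv (toList c) (toList d)
pairInv-cells []      d       = ≡.refl
pairInv-cells {p = p} (b ∷ c) [] = ∑ℕ.∑-ε (allFin p) (λ _ → ≡.refl)
pairInv-cells {p = suc p} {q = suc q} (b ∷ c) (e ∷ d) = begin
  ∑ℕ.∑ (allFin (suc p)) (λ r → ∑ℕ.∑ (allFin (suc q)) (F r))
    ≡⟨ ∑ℕ.∑-allFin-suc (λ r → ∑ℕ.∑ (allFin (suc q)) (F r)) ⟩
  ∑ℕ.∑ (allFin (suc q)) (F zero) ℕ.+ ∑ℕ.∑ (allFin p) (λ r → ∑ℕ.∑ (allFin (suc q)) (F (suc r)))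
    ≡⟨ cong₂ ℕ._+_ first (≡.trans (∑ℕ.∑-cong (allFin p) rest) (pairInv-cells c d)) ⟩
  χ (top (toList c)) (ι b) (ι e) ℕ.+ pairInv (toList c) (toList d) ∎
  where
  open ≡.≡-Reasoning
  F : Fin (suc p) → Fin (suc q) → ℕ
  F r s = 𝟙 (toℕ r ℕ.≟ toℕ s ×-dec
    𝒬? (above (b ∷ c) r) (ι (Vec.lookup (b ∷ c) r)) (ι (Vec.lookup (e ∷ d) s)))
  first : ∑ℕ.∑ (allFin (suc q)) (F zero) ≡ χ (top (toList c)) (ι b) (ι e)
  first = ≡.trans (∑ℕ.∑-allFin-suc (F zero)) (≡.trans
    (cong (F zero zero ℕ.+_) (∑ℕ.∑-ε (allFin q) (λ _ → ≡.refl))) (ℕ.+-identityʳ _))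
  rest : ∀ r → ∑ℕ.∑ (allFin (suc q)) (F (suc r)) ≡ ∑ℕ.∑ (allFin q) (λ s →
    𝟙 (toℕ r ℕ.≟ toℕ s ×-dec 𝒬? (above c r) (ι (Vec.lookup c r)) (ι (Vec.lookup d s))))
  rest r = ∑ℕ.∑-allFin-suc (F (suc r))

pairInv-columns : ∀ {p} (c : Vec (Fin n) p) (σ : Filling ps n) →
  ∑ℕ.∑ (allFin p) (λ r → ∑ℕ.∑ (cells ps) (λ v →
    𝟙 (toℕ r ℕ.≟ row v ×-dec 𝒬? (above c r) (ι (Vec.lookup c r)) (value σ v))))
  ≡ ∑ℕ.∑ (columns σ) (pairInv (toList c))
pairInv-columns {ps = []}     {p = p} c []      = ∑ℕ.∑-ε (allFin p) (λ _ → ≡.refl)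
pairInv-columns {ps = q ∷ ps} {p = p} c (d ∷ σ) = ≡.trans
  (∑ℕ.∑-cong (allFin p) (λ r → ∑ℕ-cells-∷ q ps _))
  (≡.trans (∑ℕ.∑-∙ (allFin p) _ _) (cong₂ ℕ._+_ (pairInv-cells c d) (pairInv-columns c σ)))

-- A pair has its left cell in the first column, giving the `pairInv` terms, or both cells in later
-- columns. The first column is never on the right, as no column index is below 0.
quinv-columns : (σ : Filling ps n) → quinv σ ≡ columnsInv (columns σ)
quinv-columns {ps = []}     []      = ≡.refl
quinv-columns {ps = p ∷ ps} (c ∷ σ) = begin
  quinv (c ∷ σ)
    ≡⟨ length-filter-cartesianProduct (quinvPair? (c ∷ σ)) (cells (p ∷ ps)) (cells (p ∷ ps)) ⟩
  ∑ℕ.∑ (cells (p ∷ ps)) (λ u → ∑ℕ.∑ (cells (p ∷ ps)) (F u))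
    ≡⟨ ∑ℕ-cells-∷ p ps (λ u → ∑ℕ.∑ (cells (p ∷ ps)) (F u)) ⟩
  ∑ℕ.∑ (allFin p) (λ r → ∑ℕ.∑ (cells (p ∷ ps)) (F ⟨ zero , r ⟩)) ℕ.+
  ∑ℕ.∑ (cells ps) (λ u → ∑ℕ.∑ (cells (p ∷ ps)) (F (nextColumn u)))
    ≡⟨ cong₂ ℕ._+_ (∑ℕ.∑-cong (allFin p) first) (∑ℕ.∑-cong (cells ps) next) ⟩
  ∑ℕ.∑ (allFin p) (λ r → ∑ℕ.∑ (cells ps) (λ v →
    𝟙 (toℕ r ℕ.≟ row v ×-dec 𝒬? (above c r) (ι (Vec.lookup c r)) (value σ v)))) ℕ.+
  ∑ℕ.∑ (cells ps) (λ u → ∑ℕ.∑ (cells ps) (λ v → 𝟙 (quinvPair? σ (u , v))))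
    ≡⟨ cong₂ ℕ._+_ (pairInv-columns c σ)
         (≡.trans (≡.sym (length-filter-cartesianProduct (quinvPair? σ) (cells ps) (cells ps)))
           (quinv-columns σ)) ⟩
  columnsInv (columns (c ∷ σ)) ∎
  where
  open ≡.≡-Reasoning
  F : Cell (p ∷ ps) → Cell (p ∷ ps) → ℕ
  F u v = 𝟙 (quinvPair? (c ∷ σ) (u , v))

  drop-first : ∀ u → (∀ r → ¬ QuinvPair (c ∷ σ) (u , ⟨ zero , r ⟩)) →
    ∑ℕ.∑ (cells (p ∷ ps)) (F u) ≡ ∑ℕ.∑ (cells ps) (F u ∘ nextColumn)
  drop-first u ¬pair = ≡.trans (∑ℕ-cells-∷ p ps (F u)) (cong (ℕ._+ ∑ℕ.∑ (cells ps) (F u ∘ nextColumn))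
    (∑ℕ.∑-ε (allFin p) (λ r → 𝟙-no (quinvPair? (c ∷ σ) (u , ⟨ zero , r ⟩)) (¬pair r))))

  first : ∀ r → ∑ℕ.∑ (cells (p ∷ ps)) (F ⟨ zero , r ⟩) ≡ ∑ℕ.∑ (cells ps) (λ v →
    𝟙 (toℕ r ℕ.≟ row v ×-dec 𝒬? (above c r) (ι (Vec.lookup c r)) (value σ v)))
  first r = ≡.trans (drop-first ⟨ zero , r ⟩ (λ _ → λ { (_ , () , _) }))
    (∑ℕ.∑-cong (cells ps) (λ v → 𝟙-cong (quinvPair? (c ∷ σ) (⟨ zero , r ⟩ , nextColumn v))
      (toℕ r ℕ.≟ row v ×-dec 𝒬? (above c r) (ι (Vec.lookup c r)) (value σ v))
      (λ { (r≡ , _ , q) → r≡ , subst (λ a → 𝒬 a (ι (Vec.lookup c r)) (value σ v)) (valueAbove-first c σ r) q })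
      (λ { (r≡ , q) → r≡ , s≤s z≤n ,
           subst (λ a → 𝒬 a (ι (Vec.lookup c r)) (value σ v)) (≡.sym (valueAbove-first c σ r)) q })))

  next : ∀ u → ∑ℕ.∑ (cells (p ∷ ps)) (F (nextColumn u)) ≡
               ∑ℕ.∑ (cells ps) (λ v → 𝟙 (quinvPair? σ (u , v)))
  next u = ≡.trans (drop-first (nextColumn u) (λ _ → λ { (_ , () , _) }))
    (∑ℕ.∑-cong (cells ps) (λ v → 𝟙-cong (quinvPair? (c ∷ σ) (nextColumn u , nextColumn v))
      (quinvPair? σ (u , v))
      (λ { (r≡ , i< , q) → r≡ , ℕ.s≤s⁻¹ i< ,
           subst (λ a → 𝒬 a (value σ u) (value σ v)) (valueAbove-next c σ u) q })
      (λ { (r≡ , i< , q) → r≡ , s≤s i< ,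
           subst (λ a → 𝒬 a (value σ u) (value σ v)) (≡.sym (valueAbove-next c σ u)) q })))

-- Under a row of zeros `χ` is the usual strict comparison. This identifies H̃ with a row sum.
ascents-rowInv : (w : Vec (Fin n) m) → ascents w ≡ rowInv (Vec.replicate m 0) w
ascents-rowInv []              = ≡.refl
ascents-rowInv {m = suc m} (b ∷ w) = begin
  ascents (b ∷ w)
    ≡⟨ length-filter-cartesianProduct (ascent? (b ∷ w)) (allFin (suc m)) (allFin (suc m)) ⟩
  ∑ℕ.∑ (allFin (suc m)) (λ i → ∑ℕ.∑ (allFin (suc m)) (F i))
    ≡⟨ ∑ℕ.∑-allFin-suc (λ i → ∑ℕ.∑ (allFin (suc m)) (F i)) ⟩
  ∑ℕ.∑ (allFin (suc m)) (F zero) ℕ.+ ∑ℕ.∑ (allFin m) (λ i → ∑ℕ.∑ (allFin (suc m)) (F (suc i)))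
    ≡⟨ cong₂ ℕ._+_ first (∑ℕ.∑-cong (allFin m) next) ⟩
  inv 0 b (toList w) ℕ.+ ∑ℕ.∑ (allFin m) (λ i → ∑ℕ.∑ (allFin m) (λ j → 𝟙 (ascent? w (i , j))))
    ≡⟨ cong (inv 0 b (toList w) ℕ.+_) (≡.trans
         (≡.sym (length-filter-cartesianProduct (ascent? w) (allFin m) (allFin m))) (ascents-rowInv w)) ⟩
  inv 0 b (toList w) ℕ.+ rowInv (Vec.replicate m 0) w ∎
  where
  open ≡.≡-Reasoning
  ascent? : ∀ {k} (w : Vec (Fin _) k) → Decidable (λ ((i , j) : Fin k × Fin k) →
                                           i Fin.< j × Vec.lookup w i Fin.< Vec.lookup w j)
  ascent? w (i , j) = i Fin.<? j ×-dec Vec.lookup w i Fin.<? Vec.lookup w j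
  F : Fin (suc m) → Fin (suc m) → ℕ
  F i j = 𝟙 (ascent? (b ∷ w) (i , j))
  first : ∑ℕ.∑ (allFin (suc m)) (F zero) ≡ inv 0 b (toList w)
  first = ≡.trans (∑ℕ.∑-allFin-suc (F zero)) (≡.trans
    (∑ℕ.∑-cong (allFin m) (λ j → ≡.trans
      (𝟙-cong (ascent? (b ∷ w) (zero , suc j)) (ι b ℕ.<? ι (Vec.lookup w j))
        (λ (_ , b<) → s≤s b<) (λ b< → s≤s z≤n , ℕ.s≤s⁻¹ b<))
      (≡.sym (χ-zero (ι b) (ι (Vec.lookup w j))))))
    (∑ℕ.∑-lookup w (λ d → χ 0 (ι b) (ι d))))
  next : ∀ i → ∑ℕ.∑ (allFin (suc m)) (F (suc i)) ≡ ∑ℕ.∑ (allFin m) (λ j → 𝟙 (ascent? w (i , j)))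
  next i = ≡.trans (∑ℕ.∑-allFin-suc (F (suc i)))
    (∑ℕ.∑-cong (allFin m) (λ j → 𝟙-cong (ascent? (b ∷ w) (suc i , suc j)) (ascent? w (i , j))
      (λ (i<j , w<) → ℕ.s≤s⁻¹ i<j , w<) (λ (i<j , w<) → s≤s i<j , w<)))

-- Restriction and its fibres

infixr 5 _◂_
-- A part at most k is filtered out of the truncated shape; this cons does the same to a column that
-- has become empty.
_◂_ : List A → List (List A) → List (List A)
[]      ◂ cs = cs
(b ∷ c) ◂ cs = (b ∷ c) ∷ cs

dropEmpty : List (List A) → List (List A)
dropEmpty = foldr _◂_ []

cut : ℕ → List (List A) → List (List A)
cut k = dropEmpty ∘ map (drop k)

toList-◂ : (v : Vec A m) (cs : List (List A)) → 0 ℕ.< m → toList v ◂ cs ≡ toList v ∷ cs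
toList-◂ (b ∷ v) cs _ = ≡.refl

toList-tabulate-drop : ∀ k {p} (c : Vec A p) .(eq : k ℕ.+ (p ∸ k) ≡ p) →
  toList (Vec.tabulate (λ r → Vec.lookup c (Fin.cast eq (k Fin.↑ʳ r)))) ≡ drop k (toList c)
toList-tabulate-drop zero    c       eq = cong toList (≡.trans
  (Vec.tabulate-cong (λ r → cong (Vec.lookup c) (Fin.cast-is-id eq r))) (Vec.tabulate∘lookup c))
toList-tabulate-drop (suc k) []      eq = ≡.refl
toList-tabulate-drop (suc k) (b ∷ c) eq = toList-tabulate-drop k c (ℕ.suc-injective eq)

-- A part satisfying P exceeds k and keeps a nonempty column, which `_◂_` retains; any other part is
-- at most k, so `drop k` exhausts its column.
columns-shiftFilter :
  {P : Pred ℕ Level.zero} (P? : Decidable P) (k : ℕ) (k≤ : ∀ {p} → P p → k ℕ.≤ p) →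
  (∀ {p} → P p → k ℕ.< p) → (∀ {p} → ¬ P p → p ℕ.≤ k) → (ξ : Filling ps n) →
  columns (tabulate (map (_∸ k) (filter P? ps)) (λ u → ξ at shiftFilter P? k k≤ ps u))
  ≡ cut k (columns ξ)
columns-shiftFilter {[]}     P? k k≤ k< ≤k []      = ≡.refl
columns-shiftFilter {p ∷ ps} P? k k≤ k< ≤k (c ∷ ξ) with P? p
... | yes Pp = begin
  toList v ∷ columns ξ′        ≡⟨ toList-◂ v (columns ξ′) (ℕ.m<n⇒0<n∸m (k< Pp)) ⟨
  toList v ◂ columns ξ′        ≡⟨ cong₂ _◂_ (toList-tabulate-drop k c _)
                                    (columns-shiftFilter P? k k≤ k< ≤k ξ) ⟩
  drop k (toList c) ◂ cut k (columns ξ) ∎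
  where
  open ≡.≡-Reasoning
  v  = Vec.tabulate (λ r → Vec.lookup c (Fin.cast (ℕ.m+[n∸m]≡n (k≤ Pp)) (k Fin.↑ʳ r)))
  ξ′ = tabulate (map (_∸ k) (filter P? ps)) (λ u → ξ at shiftFilter P? k k≤ ps u)
... | no ¬Pp = ≡.trans (columns-shiftFilter P? k k≤ k< ≤k ξ) (cong (_◂ cut k (columns ξ))
  (≡.sym (List.drop-all k (toList c) (ℕ.≤-trans (ℕ.≤-reflexive (Vec.length-toList c)) (≤k ¬Pp)))))

columns-restrict : ∀ k Λ (ξ : Tab Λ n) → columns (restrict k Λ ξ) ≡ cut k (columns ξ)
columns-restrict k Λ = columns-shiftFilter (k ℕ.<?_) k ℕ.<⇒≤ id ℕ.≮⇒≥

cut-cut : ∀ k (cs : List (List A)) → cut k (cut 1 cs) ≡ cut (suc k) cs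
cut-cut k []                 = ≡.refl
cut-cut k ([] ∷ cs)          = cut-cut k cs
-- A column of height one is emptied on both sides; k is split because `drop k []` reduces only
-- then.
cut-cut zero    ((b ∷ []) ∷ cs) = cut-cut zero cs
cut-cut (suc k) ((b ∷ []) ∷ cs) = cut-cut (suc k) cs
cut-cut k ((b ∷ b′ ∷ c) ∷ cs) = cong (drop k (b′ ∷ c) ◂_) (cut-cut k cs)

truncateParts-truncateParts : ∀ k ps → truncateParts k (truncateParts 1 ps) ≡ truncateParts (suc k) ps
truncateParts-truncateParts k []                = ≡.refl
truncateParts-truncateParts k (zero ∷ ps)       = truncateParts-truncateParts k ps
truncateParts-truncateParts k (suc zero ∷ ps)   = truncateParts-truncateParts k ps
truncateParts-truncateParts k (suc (suc p) ∷ ps) with k ℕ.<ᵇ suc p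
... | true  = cong (suc p ∸ k ∷_) (truncateParts-truncateParts k ps)
... | false = truncateParts-truncateParts k ps

columns-subst : ∀ {qs} (eq : ps ≡ qs) (σ : Filling ps n) →
                columns (subst (λ qs → Filling qs n) eq σ) ≡ columns σ
columns-subst ≡.refl σ = ≡.refl

-- A part equal to 1 has no column in σ and gets back a column of height one. Positivity of the
-- parts gives every letter of the new bottom row a cell.
put : All (0 ℕ.<_) ps → Vec (Fin n) (length ps) → Filling (truncateParts 1 ps) n → Filling ps n
put {[]}              []        []      []      = []
put {suc zero ∷ _}    (_ ∷ pos) (b ∷ w) σ       = (b ∷ []) ∷ put pos w σ
put {suc (suc _) ∷ _} (_ ∷ pos) (b ∷ w) (c ∷ σ) = (b ∷ c) ∷ put pos w σ

bottom : All (0 ℕ.<_) ps → Filling ps n → Vec (Fin n) (length ps)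
bottom []                     []            = []
bottom {suc _ ∷ _} (_ ∷ pos) ((b ∷ c) ∷ ξ) = b ∷ bottom pos ξ

-- The columns of σ below which put adds an entry, empty ones included.
tops : All (0 ℕ.<_) ps → Filling (truncateParts 1 ps) n → Vec (List (Fin n)) (length ps)
tops {[]}              []        []      = []
tops {suc zero ∷ _}    (_ ∷ pos) σ       = [] ∷ tops pos σ
tops {suc (suc _) ∷ _} (_ ∷ pos) (c ∷ σ) = toList c ∷ tops pos σ

dropEmpty-tops : (pos : All (0 ℕ.<_) ps) (σ : Filling (truncateParts 1 ps) n) →
                 dropEmpty (toList (tops pos σ)) ≡ columns σ
dropEmpty-tops {[]}              []        []            = ≡.refl
dropEmpty-tops {suc zero ∷ _}    (_ ∷ pos) σ             = dropEmpty-tops pos σ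
dropEmpty-tops {suc (suc _) ∷ _} (_ ∷ pos) ((b ∷ c) ∷ σ) = cong (toList (b ∷ c) ∷_) (dropEmpty-tops pos σ)

-- With the empty columns restored by `tops`, columns of height one and taller ones are treated
-- alike: each receives one letter at its lower end.
columns-put : (pos : All (0 ℕ.<_) ps) (w : Vec (Fin n) (length ps)) (σ : Filling (truncateParts 1 ps) n) →
              columns (put pos w σ) ≡ toList (Vec.zipWith _∷_ w (tops pos σ))
columns-put {[]}              []        []      []      = ≡.refl
columns-put {suc zero ∷ _}    (_ ∷ pos) (b ∷ w) σ       = cong ((b ∷ []) ∷_) (columns-put pos w σ)
columns-put {suc (suc _) ∷ _} (_ ∷ pos) (b ∷ w) (c ∷ σ) = cong (toList (b ∷ c) ∷_) (columns-put pos w σ)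

bottom-put : (pos : All (0 ℕ.<_) ps) (w : Vec (Fin n) (length ps)) (σ : Filling (truncateParts 1 ps) n) →
             bottom pos (put pos w σ) ≡ w
bottom-put {[]}              []        []      []      = ≡.refl
bottom-put {suc zero ∷ _}    (_ ∷ pos) (b ∷ w) σ       = cong (b ∷_) (bottom-put pos w σ)
bottom-put {suc (suc _) ∷ _} (_ ∷ pos) (b ∷ w) (c ∷ σ) = cong (b ∷_) (bottom-put pos w σ)

cut-zipWith : (w : Vec A m) (cs : Vec (List A) m) →
              cut 1 (toList (Vec.zipWith _∷_ w cs)) ≡ dropEmpty (toList cs)
cut-zipWith []      []       = ≡.refl
cut-zipWith (b ∷ w) (c ∷ cs) = cong (c ◂_) (cut-zipWith w cs)

-- The hypothesis is phrased through columns because the recursion consumes ξ and σ at different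
-- rates: a column of height one in ξ has no counterpart in σ.
put-bottom : (pos : All (0 ℕ.<_) ps) (ξ : Filling ps n) (σ : Filling (truncateParts 1 ps) n) →
                 columns σ ≡ cut 1 (columns ξ) → put pos (bottom pos ξ) σ ≡ ξ
put-bottom []                           []                  []      _  = ≡.refl
put-bottom {suc zero ∷ _}    (_ ∷ pos) ((b ∷ []) ∷ ξ)      σ       eq =
  cong ((b ∷ []) ∷_) (put-bottom pos ξ σ eq)
put-bottom {suc (suc _) ∷ _} (_ ∷ pos) ((b ∷ b′ ∷ c) ∷ ξ) (d ∷ σ) eq = cong₂ _∷_
  (cong (b ∷_) (≡.trans (≡.sym (Vec.cast-is-id ≡.refl d))
    (Vec.toList-injective ≡.refl d (b′ ∷ c) (List.∷-injectiveˡ eq))))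
  (put-bottom pos ξ σ (List.∷-injectiveʳ eq))

-- Enumerations, and the one-row fibre as an image of the words

words-complete : (w : Vec (Fin n) m) → w ∈ words n m
words-complete []      = here ≡.refl
words-complete (b ∷ w) = ∈-cartesianProductWith⁺ _∷_ (∈-allFin b) (words-complete w)

words-unique : ∀ n m → Unique (words n m)
words-unique n zero    = [] ∷ []
words-unique n (suc m) =
  Unique.cartesianProductWith⁺ _∷_ Vec.∷-injective (Unique.allFin⁺ n) (words-unique n m)

fillings-complete : (σ : Filling ps n) → σ ∈ fillings ps n
fillings-complete []      = here ≡.refl
fillings-complete (c ∷ σ) = ∈-cartesianProductWith⁺ _∷_ (words-complete c) (fillings-complete σ)

fillings-unique : ∀ ps n → Unique (fillings ps n)
fillings-unique []       n = [] ∷ []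
fillings-unique (p ∷ ps) n = Unique.cartesianProductWith⁺ _∷_
  (λ { ≡.refl → ≡.refl , ≡.refl }) (words-unique n p) (fillings-unique ps n)

∈-fibre⁺ : ∀ k Λ {σ : Tab (truncate k Λ) n} (ξ : Tab Λ n) → restrict k Λ ξ ≡ σ → ξ ∈ fibre k Λ σ
∈-fibre⁺ k Λ {σ} ξ eq = ∈-filter⁺ (λ ξ → restrict k Λ ξ ≟ σ) (fillings-complete ξ) eq

∈-fibre⁻ : ∀ k Λ {σ : Tab (truncate k Λ) n} {ξ : Tab Λ n} → ξ ∈ fibre k Λ σ → restrict k Λ ξ ≡ σ
∈-fibre⁻ {n} k Λ {σ} ξ∈ = proj₂ (∈-filter⁻ (λ ξ → restrict k Λ ξ ≟ σ) {xs = fillings (parts Λ) n} ξ∈)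

fibre-unique : ∀ k Λ (σ : Tab (truncate k Λ) n) → Unique (fibre k Λ σ)
fibre-unique k Λ σ = Unique.filter⁺ (λ ξ → restrict k Λ ξ ≟ σ) (fillings-unique (parts Λ) _)

restrict-put : ∀ Λ (w : Vec (Fin n) (numParts Λ)) (σ : Tab (truncate 1 Λ) n) →
               restrict 1 Λ (put (positive Λ) w σ) ≡ σ
restrict-put Λ w σ = columns-injective _ _ (begin
  columns (restrict 1 Λ (put pos w σ))                  ≡⟨ columns-restrict 1 Λ (put pos w σ) ⟩
  cut 1 (columns (put pos w σ))                         ≡⟨ cong (cut 1) (columns-put pos w σ) ⟩
  cut 1 (toList (Vec.zipWith _∷_ w (tops pos σ)))       ≡⟨ cut-zipWith w (tops pos σ) ⟩
  dropEmpty (toList (tops pos σ))                       ≡⟨ dropEmpty-tops pos σ ⟩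
  columns σ                                             ∎)
  where
  open ≡.≡-Reasoning
  pos = positive Λ

-- Putting a word below σ is a bijection from words onto the fibre, with inverse `bottom`. Both
-- lists are free of repetitions, so having the same members makes them permutations of each other.
fibre-↭-put : ∀ Λ (σ : Tab (truncate 1 Λ) n) →
  fibre 1 Λ σ ↭ map (λ w → put (positive Λ) w σ) (words n (numParts Λ))
fibre-↭-put Λ σ = ∼bag⇒↭ (unique∧set⇒bag (fibre-unique 1 Λ σ)
  (Unique.map⁺ put-injective (words-unique _ (numParts Λ)))
  (λ {ξ} → mk⇔
    (λ ξ∈ → subst (_∈ map (λ w → put pos w σ) (words _ _))
      (put-bottom pos ξ σ (≡.trans (cong columns (≡.sym (∈-fibre⁻ 1 Λ ξ∈))) (columns-restrict 1 Λ ξ)))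
      (∈-map⁺ (λ w → put pos w σ) (words-complete (bottom pos ξ))))
    (λ ξ∈ → let w , _ , ξ≡ = ∈-map⁻ (λ w → put pos w σ) ξ∈ in
      ∈-fibre⁺ 1 Λ ξ (≡.trans (cong (restrict 1 Λ) ξ≡) (restrict-put Λ w σ)))))
  where
  pos = positive Λ
  put-injective : ∀ {v w} → put pos v σ ≡ put pos w σ → v ≡ w
  put-injective {v} {w} eq =
    ≡.trans (≡.sym (bottom-put pos v σ)) (≡.trans (cong (bottom pos) eq) (bottom-put pos w σ))

-- Inversions and products after adding a bottom row

module DropEmptySum {c ℓ : Level} (M : CommutativeMonoid c ℓ) where
  open CommutativeMonoid M renaming (refl to ≈-refl; sym to ≈-sym; trans to ≈-trans)
  open ListSum M

  ∑-dropEmpty : (f : List A → Carrier) → f [] ≈ ε → (cs : List (List A)) →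
                ∑ (dropEmpty cs) f ≈ ∑ cs f
  ∑-dropEmpty f f[]≈ε []             = ≈-refl
  ∑-dropEmpty f f[]≈ε ([] ∷ cs)      =
    ≈-trans (∑-dropEmpty f f[]≈ε cs) (≈-sym (≈-trans (∙-congʳ f[]≈ε) (identityˡ _)))
  ∑-dropEmpty f f[]≈ε ((b ∷ c) ∷ cs) = ∙-congˡ (∑-dropEmpty f f[]≈ε cs)

  ∑-zipWith-∷ : (f : A → Carrier) (w : Vec A m) (cs : Vec (List A) m) →
    ∑ (toList (Vec.zipWith _∷_ w cs)) (λ c → ∑ c f) ≈
    ∑ (toList w) f ∙ ∑ (toList cs) (λ c → ∑ c f)
  ∑-zipWith-∷ f []      []       = ≈-sym (identityˡ ε)
  ∑-zipWith-∷ f (b ∷ w) (c ∷ cs) = ≈-trans (∙-congˡ (∑-zipWith-∷ f w cs)) (interchange _ _ _ _)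
    where open CommutativeSemigroup commutativeSemigroup using (interchange)

columnsInv-dropEmpty : (cs : List (List (Fin n))) → columnsInv (dropEmpty cs) ≡ columnsInv cs
columnsInv-dropEmpty []             = ≡.refl
columnsInv-dropEmpty ([] ∷ cs)      = ≡.trans (columnsInv-dropEmpty cs)
  (cong (ℕ._+ columnsInv cs) (≡.sym (∑ℕ.∑-ε cs (λ _ → ≡.refl))))
columnsInv-dropEmpty ((b ∷ c) ∷ cs) = cong₂ ℕ._+_
  (DropEmptySum.∑-dropEmpty ℕ.+-0-commutativeMonoid (pairInv (b ∷ c)) ≡.refl cs) (columnsInv-dropEmpty cs)

-- Every old entry keeps the entry above it, so old pairs are unaffected; the new pairs compare w
-- under the former lowest entries, with 0 where a column was empty.
columnsInv-zipWith-∷ : (w : Vec (Fin n) m) (cs : Vec (List (Fin n)) m) →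
  columnsInv (toList (Vec.zipWith _∷_ w cs)) ≡ rowInv (Vec.map top cs) w ℕ.+ columnsInv (toList cs)
columnsInv-zipWith-∷ []      []       = ≡.refl
columnsInv-zipWith-∷ (b ∷ w) (c ∷ cs) = ≡.trans
  (cong₂ ℕ._+_ (bottomPairs w cs) (columnsInv-zipWith-∷ w cs))
  (interchange (inv (top c) b (toList w)) _ _ _)
  where
  open CommutativeSemigroup ℕ.+-commutativeSemigroup using (interchange)
  bottomPairs : ∀ {m} (w : Vec (Fin _) m) (cs : Vec (List (Fin _)) m) →
    ∑ℕ.∑ (toList (Vec.zipWith _∷_ w cs)) (pairInv (b ∷ c)) ≡
    inv (top c) b (toList w) ℕ.+ ∑ℕ.∑ (toList cs) (pairInv c)
  bottomPairs []      []       = ≡.refl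
  bottomPairs (e ∷ w) (d ∷ cs) = ≡.trans
    (cong (pairInv (b ∷ c) (e ∷ d) ℕ.+_) (bottomPairs w cs))
    (interchange (χ (top c) (ι b) (ι e)) (pairInv c d) _ _)

filter-filter-⊆ : {P : Pred A a} {Q : Pred A b} (P? : Decidable P) (Q? : Decidable Q) →
  (∀ {x} → P x → Q x) → (xs : List A) → filter P? (filter Q? xs) ≡ filter P? xs
filter-filter-⊆ P? Q? P⇒Q []       = ≡.refl
filter-filter-⊆ P? Q? P⇒Q (x ∷ xs) with P? x
... | yes Px = ≡.trans (cong (filter P?) (List.filter-accept Q? (P⇒Q Px)))
  (≡.trans (List.filter-accept P? Px) (cong (x ∷_) (filter-filter-⊆ P? Q? P⇒Q xs)))
... | no ¬Px with Q? x
... | yes _ = ≡.trans (List.filter-reject P? ¬Px) (filter-filter-⊆ P? Q? P⇒Q xs)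
... | no  _ = filter-filter-⊆ P? Q? P⇒Q xs

-- Weights and laws

module Marginal {c ℓ₁ ℓ₂ ℓ₃ : Level} (F : OrderedField c ℓ₁ ℓ₂ ℓ₃) where
  open OrderedField F hiding (_^_) renaming (refl to ≈-refl; sym to ≈-sym; trans to ≈-trans)

  commutativeSemiring : CommutativeSemiring c ℓ₁
  commutativeSemiring = record { isCommutativeSemiring = isCommutativeSemiring }

  open CommutativeSemiring commutativeSemiring
    using (+-commutativeMonoid; *-commutativeMonoid; *-commutativeSemigroup)
  open Exp semiring using (_^_; ^-homo-*)
  open CommutativeSemigroup *-commutativeSemigroup using (interchange)
  open ≈-Reasoning setoid
  module ∑F = ListSum +-commutativeMonoid
  module ∏F = ListSum *-commutativeMonoid

  module _ {n : ℕ} (x : Fin n → Carrier) (t : Carrier) where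
    open RowSum commutativeSemiring t n

    wt-columns : ∀ Λ (σ : Tab Λ n) →
      wt F x t Λ σ ≈ t ^ columnsInv (columns σ) * ∏ (columns σ) (λ c → ∏ c x)
    wt-columns Λ σ = *-cong (reflexive (cong (t ^_) (quinv-columns σ)))
      (CellSum.∑-entries *-commutativeMonoid σ x)

    ∏-symmetric : Symmetric (λ w → ∏ w x)
    ∏-symmetric = ∏F.∑-↭ x

    H̃-rowSum : ∀ m → H̃⟨1^_⟩ F m x t ≈ rowSum (Vec.replicate m 0) (λ w → ∏ w x)
    H̃-rowSum m = ∑F.∑-cong (words n m) (λ w →
      *-cong (reflexive (cong (t ^_) (ascents-rowInv w))) (∏F.∑-lookup w x))

    wt-put : ∀ Λ (w : Vec (Fin n) (numParts Λ)) (σ : Tab (truncate 1 Λ) n) →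
      wt F x t Λ (put (positive Λ) w σ) ≈
      t ^ rowInv (Vec.map top (tops (positive Λ) σ)) w * ∏ (toList w) x * wt F x t (truncate 1 Λ) σ
    wt-put Λ w σ = begin
      wt F x t Λ (put pos w σ)
        ≈⟨ wt-columns Λ (put pos w σ) ⟩
      t ^ columnsInv (columns (put pos w σ)) * ∏ (columns (put pos w σ)) (λ c → ∏ c x)
        ≡⟨ cong (λ cs → t ^ columnsInv cs * ∏ cs (λ c → ∏ c x)) (columns-put pos w σ) ⟩
      t ^ columnsInv cs⁺ * ∏ cs⁺ (λ c → ∏ c x)
        ≈⟨ *-cong
             (≈-trans (reflexive (cong (t ^_) (columnsInv-zipWith-∷ w cs)))
                      (^-homo-* t (rowInv (Vec.map top cs) w) (columnsInv (toList cs))))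
             (DropEmptySum.∑-zipWith-∷ *-commutativeMonoid x w cs) ⟩
      t ^ rowInv (Vec.map top cs) w * t ^ columnsInv (toList cs) *
        (∏ (toList w) x * ∏ (toList cs) (λ c → ∏ c x))
        ≈⟨ interchange _ _ _ _ ⟩
      t ^ rowInv (Vec.map top cs) w * ∏ (toList w) x *
        (t ^ columnsInv (toList cs) * ∏ (toList cs) (λ c → ∏ c x))
        ≈⟨ *-congˡ (*-cong (reflexive (cong (t ^_) (columnsInv-dropEmpty (toList cs))))
             (DropEmptySum.∑-dropEmpty *-commutativeMonoid (λ c → ∏ c x) ≈-refl (toList cs))) ⟨
      t ^ rowInv (Vec.map top cs) w * ∏ (toList w) x *
        (t ^ columnsInv (dropEmpty (toList cs)) * ∏ (dropEmpty (toList cs)) (λ c → ∏ c x))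
        ≡⟨ cong (λ ds → t ^ rowInv (Vec.map top cs) w * ∏ (toList w) x *
                        (t ^ columnsInv ds * ∏ ds (λ c → ∏ c x))) (dropEmpty-tops pos σ) ⟩
      t ^ rowInv (Vec.map top cs) w * ∏ (toList w) x *
        (t ^ columnsInv (columns σ) * ∏ (columns σ) (λ c → ∏ c x))
        ≈⟨ *-congˡ (wt-columns (truncate 1 Λ) σ) ⟨
      t ^ rowInv (Vec.map top cs) w * ∏ (toList w) x * wt F x t (truncate 1 Λ) σ ∎
      where
      pos = positive Λ
      cs  = tops pos σ
      cs⁺ = toList (Vec.zipWith _∷_ w cs)

    ∑-fibre-1 : ∀ Λ (σ : Tab (truncate 1 Λ) n) →
      ∑ (fibre 1 Λ σ) (wt F x t Λ) ≈ H̃⟨1^_⟩ F (numParts Λ) x t * wt F x t (truncate 1 Λ) σ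
    ∑-fibre-1 Λ σ = begin
      ∑ (fibre 1 Λ σ) (wt F x t Λ)
        ≈⟨ ∑F.∑-↭ (wt F x t Λ) (fibre-↭-put Λ σ) ⟩
      ∑ (map (λ w → put (positive Λ) w σ) (words n (numParts Λ))) (wt F x t Λ)
        ≈⟨ ∑F.∑-map (λ w → put (positive Λ) w σ) (words n (numParts Λ)) (wt F x t Λ) ⟩
      ∑ (words n (numParts Λ)) (λ w → wt F x t Λ (put (positive Λ) w σ))
        ≈⟨ ∑F.∑-cong (words n (numParts Λ)) (λ w → wt-put Λ w σ) ⟩
      ∑ (words n (numParts Λ)) (λ w →
        t ^ rowInv us w * ∏ (toList w) x * wt F x t (truncate 1 Λ) σ)
        ≈⟨ ∑-*ʳ (wt F x t (truncate 1 Λ) σ) (words n (numParts Λ)) _ ⟩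
      rowSum us (λ w → ∏ w x) * wt F x t (truncate 1 Λ) σ
        -- Here the dependence of the factor on the lowest entries of σ disappears.
        ≈⟨ *-congʳ (rowSum-zero us ∏-symmetric) ⟩
      rowSum (Vec.replicate (numParts Λ) 0) (λ w → ∏ w x) * wt F x t (truncate 1 Λ) σ
        ≈⟨ *-congʳ (H̃-rowSum (numParts Λ)) ⟨
      H̃⟨1^_⟩ F (numParts Λ) x t * wt F x t (truncate 1 Λ) σ ∎
      where
      us = Vec.map top (tops (positive Λ) σ)

    -- The fibre for k + 1 rows is split by what remains after removing one row. Each piece is a
    -- full one-row fibre with factor H̃, and the pieces are indexed by a fibre for k rows.
    ∑-fibre-suc : ∀ k Λ {r} →
      (∀ σ → ∑ (fibre k (truncate 1 Λ) σ) (wt F x t (truncate 1 Λ)) ≈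
             r * wt F x t (truncate k (truncate 1 Λ)) σ) →
      (σ : Tab (truncate (suc k) Λ) n) →
      ∑ (fibre (suc k) Λ σ) (wt F x t Λ) ≈
      H̃⟨1^_⟩ F (numParts Λ) x t * r * wt F x t (truncate (suc k) Λ) σ
    ∑-fibre-suc k Λ {r} ∑≈ σ = begin
      ∑ (fibre (suc k) Λ σ) (wt F x t Λ)
        ≈⟨ ∑F.∑-fibres _≟_ (restrict 1 Λ) (fibre-unique k Λ′ σ′) (fibre (suc k) Λ σ) (wt F x t Λ)
             (λ {ξ} ξ∈ → ∈-fibre⁺ k Λ′ (restrict 1 Λ ξ) (columns-injective _ σ′
               (≡.trans (restrict-restrict ξ)
               (≡.trans (cong columns (∈-fibre⁻ (suc k) Λ ξ∈)) (≡.sym cols))))) ⟨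
      ∑ (fibre k Λ′ σ′) (λ τ →
        ∑ (filter (λ ξ → restrict 1 Λ ξ ≟ τ) (fibre (suc k) Λ σ)) (wt F x t Λ))
        -- Restricting to τ already forces the restriction by `suc k` to be σ, so the outer filter
        -- alone remains.
        ≈⟨ ∑F.∑-cong-∈ (fibre k Λ′ σ′) (λ {τ} τ∈ → reflexive (cong (λ ξs → ∑ ξs (wt F x t Λ))
             (filter-filter-⊆ (λ ξ → restrict 1 Λ ξ ≟ τ) (λ ξ → restrict (suc k) Λ ξ ≟ σ)
               (λ {ξ} eq → columns-injective _ σ
                 (≡.trans (≡.sym (restrict-restrict ξ))
                 (≡.trans (cong columns (≡.trans (cong (restrict k Λ′) eq) (∈-fibre⁻ k Λ′ τ∈))) cols)))
               (fillings (parts Λ) n)))) ⟩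
      ∑ (fibre k Λ′ σ′) (λ τ → ∑ (fibre 1 Λ τ) (wt F x t Λ))
        ≈⟨ ∑F.∑-cong (fibre k Λ′ σ′) (∑-fibre-1 Λ) ⟩
      ∑ (fibre k Λ′ σ′) (λ τ → H * wt F x t Λ′ τ)
        ≈⟨ ∑-*ˡ H (fibre k Λ′ σ′) (wt F x t Λ′) ⟩
      H * ∑ (fibre k Λ′ σ′) (wt F x t Λ′)
        ≈⟨ *-congˡ (∑≈ σ′) ⟩
      H * (r * wt F x t (truncate k Λ′) σ′)
        ≈⟨ *-assoc H r _ ⟨
      H * r * wt F x t (truncate k Λ′) σ′
        ≈⟨ *-congˡ (≈-trans (wt-columns (truncate k Λ′) σ′) (≈-trans
             (reflexive (cong (λ cs → t ^ columnsInv cs * ∏ cs (λ c → ∏ c x)) cols))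
             (≈-sym (wt-columns (truncate (suc k) Λ) σ)))) ⟩
      H * r * wt F x t (truncate (suc k) Λ) σ ∎
      where
      Λ′ = truncate 1 Λ
      H  = H̃⟨1^_⟩ F (numParts Λ) x t
      eq = ≡.sym (truncateParts-truncateParts k (parts Λ))
      σ′ : Tab (truncate k Λ′) n
      σ′ = subst (λ qs → Filling qs n) eq σ
      cols : columns σ′ ≡ columns σ
      cols = columns-subst eq σ
      restrict-restrict : ∀ ξ → columns (restrict k Λ′ (restrict 1 Λ ξ)) ≡
                                columns (restrict (suc k) Λ ξ)
      restrict-restrict ξ = ≡.trans (columns-restrict k Λ′ (restrict 1 Λ ξ))
        (≡.trans (cong (cut k) (columns-restrict 1 Λ ξ))
        (≡.trans (cut-cut k (columns ξ)) (≡.sym (columns-restrict (suc k) Λ ξ))))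

    -- The factor r is a product of k factors H̃, one for the number of parts of each successive
    -- truncation, beginning with Λ itself.
    ∑-fibre : ∀ k Λ → 1 ℕ.≤ k → ∃[ r ] (∀ (σ : Tab (truncate k Λ) n) →
      ∑ (fibre k Λ σ) (wt F x t Λ) ≈ r * wt F x t (truncate k Λ) σ)
    ∑-fibre (suc zero)      Λ _ = H̃⟨1^_⟩ F (numParts Λ) x t , ∑-fibre-1 Λ
    ∑-fibre (suc k@(suc _)) Λ _ =
      let r , ∑≈ = ∑-fibre k (truncate 1 Λ) (s≤s z≤n)
      in  H̃⟨1^_⟩ F (numParts Λ) x t * r , ∑-fibre-suc k Λ ∑≈

  -- Nonnegativity and the law of the restriction

  module < = IsStrictPartialOrder isStrictPartialOrder

  -- Since 0 ≤ y only refutes y < 0, the argument goes through apartness: by cotransitivity z is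
  -- apart from y + z or from 0, and each resulting inequality yields y < 0 or z < 0.
  +-nonNegative : ∀ {y z} → 0# ≤ y → 0# ≤ z → 0# ≤ y + z
  +-nonNegative {y} {z} y≥0 z≥0 y+z<0 with #-cotrans (<⇒# y+z<0) z
  ... | inj₂ z#0 with #⇒<⊎> z#0
  ...   | inj₁ z<0 = z≥0 z<0
  ...   | inj₂ 0<z = y≥0 (<.trans
    (<.<-respʳ-≈ (+-comm z y) (<.<-respˡ-≈ (+-identityˡ y) (+-monoˡ-< y 0<z))) y+z<0)
  +-nonNegative {y} {z} y≥0 z≥0 y+z<0 | inj₁ y+z#z with #⇒<⊎> y+z#z
  ...   | inj₁ y+z<z = y≥0 (<.<-respˡ-≈ (cancel y z) (<.<-respʳ-≈ (-‿inverseʳ z) (+-monoˡ-< (- z) y+z<z)))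
    where
    cancel : ∀ y z → y + z - z ≈ y
    cancel y z = ≈-trans (+-assoc y z (- z)) (≈-trans (+-congˡ (-‿inverseʳ z)) (+-identityʳ y))
  ...   | inj₂ z<y+z = z≥0 (<.trans z<y+z y+z<0)

  ∑-nonNegative : (xs : List A) {f : A → Carrier} → (∀ x → 0# ≤ f x) → 0# ≤ ∑ xs f
  ∑-nonNegative []       f≥0 = <.irrefl ≈-refl
  ∑-nonNegative (x ∷ xs) f≥0 = +-nonNegative (f≥0 x) (∑-nonNegative xs f≥0)

  restrictedLaw-∝ : ∀ {n} (x : Fin n → Carrier) t k Λ → 1 ℕ.≤ k → (P : Tab Λ n → Carrier) →
    IsLaw∝ F Λ (wt F x t Λ) P →
    IsLaw∝ F (truncate k Λ) (wt F x t (truncate k Λ)) (restrictedLaw F k Λ P)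
  restrictedLaw-∝ {n} x t k Λ 1≤k P law = record
    { nonNegative  = λ σ → ∑-nonNegative (fibre k Λ σ) nonNegative
    -- The fibres partition all fillings, so the total mass is preserved.
    ; normalised   = ≈-trans
        (∑F.∑-fibres _≟_ (restrict k Λ) (fillings-unique (parts (truncate k Λ)) n) (fillings (parts Λ) n) P
          (λ {ξ} _ → fillings-complete (restrict k Λ ξ)))
        normalised
    -- Here s relates P to the weight on Λ, and r is the factor gained by summing that weight over a
    -- fibre.
    ; proportional = s * r , λ σ → begin
        ∑ (fibre k Λ σ) P                          ≈⟨ ∑F.∑-cong (fibre k Λ σ) P≈ ⟩
        ∑ (fibre k Λ σ) (λ ξ → s * wt F x t Λ ξ)   ≈⟨ ∑-*ˡ s (fibre k Λ σ) (wt F x t Λ) ⟩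
        s * ∑ (fibre k Λ σ) (wt F x t Λ)           ≈⟨ *-congˡ (∑r σ) ⟩
        s * (r * wt F x t (truncate k Λ) σ)        ≈⟨ *-assoc s r _ ⟨
        s * r * wt F x t (truncate k Λ) σ          ∎
    }
    where
    open IsLaw∝ law
    open RowSum commutativeSemiring t n using (∑-*ˡ)
    s  = proj₁ proportional
    P≈ = proj₂ proportional
    r  = proj₁ (∑-fibre x t k Λ 1≤k)
    ∑r = proj₂ (∑-fibre x t k Λ 1≤k)

theorem8 : {c ℓ₁ ℓ₂ ℓ₃ : Level} (F : OrderedField c ℓ₁ ℓ₂ ℓ₃) →
    let open OrderedField F in
    (Λ : Partition) (n : ℕ) → 1 ℕ.≤ n →
    (x : Fin n → Carrier) → (∀ i → 0# < x i) →
    (t : Carrier) → 0# ≤ t →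
    ((k : ℕ) → 1 ℕ.≤ k → k ℕ.< firstPart Λ →
    (P : Tab Λ n → Carrier) → IsLaw∝ F Λ (wt F x t Λ) P →
    IsLaw∝ F (truncate k Λ) (wt F x t (truncate k Λ)) (restrictedLaw F k Λ P))
    ×
    (1 ℕ.< firstPart Λ →
    (σ : Tab (truncate 1 Λ) n) →
    ∑ (fibre 1 Λ σ) (wt F x t Λ)
    ≈ H̃⟨1^_⟩ F (numParts Λ) x t * wt F x t (truncate 1 Λ) σ)
theorem8 F Λ n _ x _ t _ =
  (λ k 1≤k _ → restrictedLaw-∝ x t k Λ 1≤k) , (λ _ → ∑-fibre-1 x t Λ)
  where open Marginal F
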